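{- For all $k,p\in\mathbb{N}$, the class of graphs of treewidth at most $k$ admits polynomial time computable $p$-centered colorings with $\binom{p+k}{k}$ colors.
   Context: All graphs are finite, simple and undirected. A coloring $\lambda\colon V(G)\to C$ is $p$-centered if for every connected subgraph $H$ of $G$, either $H$ receives more than $p$ colors under $\lambda$, or there is a color that appears exactly once in $H$ under $\lambda$. A class $\mathscr{C}$ admits $p$-centered colorings with $f(p)$ colors if for every $p\in\mathbb{N}$ every $G\in\mathscr{C}$ admits a $p$-centered coloring using at most $f(p)$ colors. These are polynomial time computable if there is an algorithm that, given $p$ and $G\in\mathscr{C}$ with $n$ vertices, computes such a coloring in time $c\cdot n^c$, where the constant $c$ may depend on $\mathscr{C}$ (here: on $k$) but not on $p$. -}

module Defs where

open import Data.Bool.Base using (Bool; true; false; _∧_; if_then_else_)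
open import Data.Bool.Properties using (∧-comm)
open import Data.Fin.Base using (Fin; zero; suc; toℕ; fromℕ; inject₁)
open import Data.Fin.Properties using (any?; _≟_)
open import Data.Fin.Subset using (Subset; ⊤; _∈_; Nonempty; ∣_∣)
open import Data.Fin.Subset.Properties using (_∈?_)
import Data.List.Base as List
open import Data.List.Base using (List)
open import Data.Nat.Base using (ℕ; zero; suc; _+_; _*_; _^_; _≤_; _>_; _⊔_)
open import Data.Product.Base using (Σ; ∃-syntax; _×_)
open import Data.Product using (∃!)
open import Data.Sum.Base using (_⊎_)
open import Data.Vec.Base using (Vec; lookup; tabulate; replicate; head; _∷_; _[_]≔_)
open import Data.Vec.Properties using (lookup⇒[]=)
open import Function.Definitions using (Injective)
open import Relation.Binary.Construct.Closure.ReflexiveTransitive using (Star)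
open import Relation.Binary.PropositionalEquality using (_≡_; refl; cong₂)
open import Relation.Nullary.Decidable.Core using (does; _×-dec_)
open import Relation.Nullary.Negation.Core using (¬_)

------------------------------------------------------------------------
-- Graphs

record Graph (n : ℕ) : Set where
  field
    adj       : Fin n → Fin n → Bool
    symmetric : ∀ u v → adj u v ≡ adj v u
    loopless  : ∀ u → adj u u ≡ false

  Adj : Fin n → Fin n → Set
  Adj u v = adj u v ≡ true

open Graph public

GraphClass : Set₁
GraphClass = ∀ {n} → Graph n → Set

record Subgraph {n} (G : Graph n) : Set where
  field
    vertices  : Subset n
    edge      : Fin n → Fin n → Bool
    edge-sym  : ∀ u v → edge u v ≡ edge v u
    edge⇒adj  : ∀ u v → edge u v ≡ true → Adj G u v
    edge⇒∈    : ∀ u v → edge u v ≡ true → u ∈ vertices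

  Edge : Fin n → Fin n → Set
  Edge u v = edge u v ≡ true

open Subgraph public

-- The empty subgraph is not connected.
Connected : ∀ {n} {G : Graph n} → Subgraph G → Set
Connected H =
  Nonempty (vertices H) ×
  (∀ u v → u ∈ vertices H → v ∈ vertices H → Star (Edge H) u v)

private
  ∧-true₁ : ∀ {x y} → x ∧ y ≡ true → x ≡ true
  ∧-true₁ {true} _ = refl

  ∧-true₂ : ∀ {x y} → x ∧ y ≡ true → y ≡ true
  ∧-true₂ {true} e = e

induced : ∀ {n} (G : Graph n) → Subset n → Subgraph G
induced G S = record
  { vertices = S
  ; edge     = λ u v → adj G u v ∧ (lookup S u ∧ lookup S v)
  ; edge-sym = λ u v → cong₂ _∧_ (symmetric G u v) (∧-comm (lookup S u) (lookup S v))
  ; edge⇒adj = λ u v e → ∧-true₁ e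
  ; edge⇒∈   = λ u v e → lookup⇒[]= u S (∧-true₁ (∧-true₂ {adj G u v} e))
  }

------------------------------------------------------------------------
-- Treewidth

record Cycle {n} (G : Graph n) : Set where
  field
    {excess}  : ℕ
    vertex    : Fin (3 + excess) → Fin n
    injective : Injective _≡_ _≡_ vertex
    step      : ∀ i → Adj G (vertex (inject₁ i)) (vertex (suc i))
    close     : Adj G (vertex (fromℕ (2 + excess))) (vertex zero)

IsTree : ∀ {n} → Graph n → Set
IsTree T = Connected (induced T ⊤) × ¬ Cycle T

record TreeDecomposition {n} (G : Graph n) : Set where
  field
    {size} : ℕ
    tree   : Graph size
    isTree : IsTree tree
    bag    : Fin size → Subset n

  nodesOf : Fin n → Subset size
  nodesOf v = tabulate (λ t → lookup (bag t) v)

  field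
    edgeCovered : ∀ u v → Adj G u v → ∃[ t ] (u ∈ bag t × v ∈ bag t)
    -- By nonemptiness this also says that every vertex lies in some bag.
    nodesConnected : ∀ v → Connected (induced tree (nodesOf v))

open TreeDecomposition public

-- The width of a decomposition is the maximal bag size minus one.
TreewidthAtMost : ℕ → GraphClass
TreewidthAtMost k G =
  Σ (TreeDecomposition G) λ D → ∀ t → ∣ bag D t ∣ ≤ suc k

------------------------------------------------------------------------
-- Centered colorings

Coloring : ℕ → ℕ → Set
Coloring n q = Fin n → Fin q

image : ∀ {n q} → Coloring n q → Subset n → Subset q
image col S = tabulate λ c → does (any? λ v → (v ∈? S) ×-dec (col v ≟ c))

Centered : ∀ {n q} → ℕ → (G : Graph n) → Coloring n q → Set
Centered p G col = (H : Subgraph G) → Connected H →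
  ∣ image col (vertices H) ∣ > p ⊎
  ∃[ c ] ∃! _≡_ (λ v → v ∈ vertices H × col v ≡ c)

------------------------------------------------------------------------
-- Algorithms: Jones's WHILE language over binary trees, with its
-- usual time measure, which is polynomially related to Turing machine
-- time.  Every operation is a constant-time one on a pointer machine;
-- in particular, `_∙_` allocates one cell and an assignment copies a
-- pointer.

infixr 5 _∙_ _∙ᵉ_
infix  4 _≔_
infixr 3 _⨾_

data Data : Set where
  nil : Data
  _∙_ : Data → Data → Data

hd tl : Data → Data
hd nil     = nil
hd (a ∙ _) = a
tl nil     = nil
tl (_ ∙ b) = b

data Expr (m : ℕ) : Set where
  var     : Fin m → Expr m
  nilᵉ    : Expr m
  _∙ᵉ_    : Expr m → Expr m → Expr m
  hdᵉ tlᵉ : Expr m → Expr m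

data Cmd (m : ℕ) : Set where
  _≔_                : Fin m → Expr m → Cmd m
  _⨾_                : Cmd m → Cmd m → Cmd m
  ifᵉ_then_else_     : Expr m → Cmd m → Cmd m → Cmd m
  while_loop_        : Expr m → Cmd m → Cmd m

Store : ℕ → Set
Store = Vec Data

eval : ∀ {m} → Expr m → Store m → Data
eval (var x)  σ = lookup σ x
eval nilᵉ     σ = nil
eval (d ∙ᵉ e) σ = eval d σ ∙ eval e σ
eval (hdᵉ e)  σ = hd (eval e σ)
eval (tlᵉ e)  σ = tl (eval e σ)

cost : ∀ {m} → Expr m → ℕ
cost (var x)  = 1
cost nilᵉ     = 1
cost (d ∙ᵉ e) = suc (cost d + cost e)
cost (hdᵉ e)  = suc (cost e)
cost (tlᵉ e)  = suc (cost e)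

-- σ ⊢ c ⇓[ t ] τ : started in store σ, the command c halts after time
-- t in store τ.  In tests, nil is false and every pair is true.
infix 2 _⊢_⇓[_]_

data _⊢_⇓[_]_ {m} (σ : Store m) : Cmd m → ℕ → Store m → Set where
  assign : ∀ {x e} →
    σ ⊢ x ≔ e ⇓[ suc (cost e) ] σ [ x ]≔ eval e σ
  seq : ∀ {c d s t τ υ} →
    σ ⊢ c ⇓[ s ] τ → τ ⊢ d ⇓[ t ] υ →
    σ ⊢ c ⨾ d ⇓[ s + t ] υ
  if-true : ∀ {e c d t τ a b} → eval e σ ≡ a ∙ b →
    σ ⊢ c ⇓[ t ] τ →
    σ ⊢ ifᵉ e then c else d ⇓[ suc (cost e + t) ] τ
  if-false : ∀ {e c d t τ} → eval e σ ≡ nil →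
    σ ⊢ d ⇓[ t ] τ →
    σ ⊢ ifᵉ e then c else d ⇓[ suc (cost e + t) ] τ
  while-true : ∀ {e c s t τ υ a b} → eval e σ ≡ a ∙ b →
    σ ⊢ c ⇓[ s ] τ → τ ⊢ while e loop c ⇓[ t ] υ →
    σ ⊢ while e loop c ⇓[ suc (cost e + (s + t)) ] υ
  while-false : ∀ {e c} → eval e σ ≡ nil →
    σ ⊢ while e loop c ⇓[ suc (cost e) ] σ

record Program : Set where
  field
    locals : ℕ
    body   : Cmd (suc locals)

open Program public

-- Variable zero holds both the input and the output.
infix 2 _⟨_⟩⇓[_]_

_⟨_⟩⇓[_]_ : Program → Data → ℕ → Data → Set
P ⟨ input ⟩⇓[ t ] output =
  ∃[ τ ] ((input ∷ replicate (locals P) nil ⊢ body P ⇓[ t ] τ) × head τ ≡ output)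

------------------------------------------------------------------------
-- Inputs and outputs: a graph is given by its adjacency matrix and a
-- coloring by the list of the colors of the vertices.  Numbers are
-- unary.

encodeList : List Data → Data
encodeList = List.foldr _∙_ nil

encodeℕ : ℕ → Data
encodeℕ zero    = nil
encodeℕ (suc n) = nil ∙ encodeℕ n

encodeBool : Bool → Data
encodeBool b = if b then nil ∙ nil else nil

encodeGraph : ∀ {n} → Graph n → Data
encodeGraph G =
  encodeList (List.tabulate λ u → encodeList (List.tabulate λ v → encodeBool (adj G u v)))

encodeColoring : ∀ {n q} → Coloring n q → Data
encodeColoring col = encodeList (List.tabulate λ v → encodeℕ (toℕ (col v)))

-- One program and one constant c serve all p and all graphs of the
-- class.  The bound c · n ^ c is read as c for the empty graph, where it
-- would otherwise be 0; it does not depend on p, so a program may be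
-- unable to read all of its input p.
AdmitsPolyTimeCenteredColorings : GraphClass → (ℕ → ℕ) → Set
AdmitsPolyTimeCenteredColorings 𝒞 f =
  Σ Program λ P → ∃[ c ] (∀ p {n} (G : Graph n) → 𝒞 G →
    Σ (Coloring n (f p)) λ col → ∃[ t ]
      ( (P ⟨ encodeℕ p ∙ encodeGraph G ⟩⇓[ t ] encodeColoring col)
      × t ≤ c * (1 ⊔ n) ^ c
      × Centered p G col))

-- A vertex set K is won if it has a vertex v such that all components of K − v are won; only components of
-- G − S with |S| ≤ k are considered, so a table indexed by (S, r) ∈ Vᵏ × V suffices and polynomially many
-- steps fill it.  Given treewidth at most k, the vertex of K that comes last in an elimination ordering is
-- a winning choice, because the boundary of every component left over lies in a single bag.
--
-- Playing the winning choices from the whole graph removes the vertices one by one, v being removed from the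
-- component K_v.  The parents of v are the at most k neighbours of K_v.  If y and z are parents of x, then the
-- older of the two is a parent of the other.  Hence v has at most C (p + k, k) ancestors within p parent steps:
-- of the ancestors of x, those not reached from k − w given parents are x itself and those reached from the
-- remaining parents, which taken from the oldest on contribute C (p − 1 + w, w), C (p − 2 + w, w − 1), ….
-- So the greedy colouring that distinguishes v from these ancestors needs that many colours only.
--
-- A connected subgraph H has a vertex v that lies in no K_u with u ∈ H other than v.  From u ∈ H, u ≠ v, a
-- path in H to v leaves K_u through a parent of u in H.  Iterating, either v is reached within p steps and has
-- another colour than u, or the first p + 1 vertices met have distinct colours.
--
-- The running time is bounded syntactically: programs are written in a total language whose loops all run n or
-- min (p, n) times.
module Submission where

open import Defs
open import Data.Bool.Base using (Bool; true; false; if_then_else_)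
import Data.Bool.Properties as Bool
open import Data.Empty using (⊥; ⊥-elim)
open import Data.Fin.Base using (Fin; zero; suc; toℕ; fromℕ; fromℕ<; inject₁; inject≤)
open import Data.Fin.Patterns using (0F; 1F; 2F; 3F; 4F)
open import Data.Fin.Properties using
  (_≟_; all?; any?; inject≤-injective; injective⇒≤; toℕ-fromℕ; toℕ-fromℕ<; toℕ-inject₁; toℕ-inject≤; toℕ-injective; toℕ<n)
open import Data.Fin.Relation.Unary.Top using (view; ‵fromℕ; ‵inject₁)
open import Data.Fin.Subset using (Subset; ⊤; ⁅_⁆; _∈_; Nonempty; ∣_∣) renaming (_-_ to _∖_)
open import Data.Fin.Subset.Properties using
  (_∈?_; ∈⊤; nonempty?; p─q⊆p; x∈p∧x≢y⇒x∈p-y; x∈p⇒∣p-x∣<∣p∣; p⊆q⇒∣p∣≤∣q∣; p⊂q⇒∣p∣<∣q∣; ∣p∣≤n; ∣⊤∣≡n; ∣p∣≡n⇒p≡⊤)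
import Data.List.Base as List
open import Data.List.Base using (List; []; _∷_; _++_; length)
open import Data.List.Membership.Propositional using () renaming (_∈_ to _∈ˡ_; _∉_ to _∉ˡ_)
open import Data.List.Membership.Propositional.Properties using (∈-++⁺ˡ; ∈-++⁺ʳ; ∈-lookup)
open import Data.List.Properties using (length-++; length-map; length-tabulate) renaming (tabulate-cong to List-tabulate-cong)
import Data.List.Relation.Unary.All as All
open import Data.List.Relation.Unary.All using (All; []; _∷_)
import Data.List.Relation.Unary.All.Properties as All
import Data.List.Relation.Unary.AllPairs as AllPairs
open import Data.List.Relation.Unary.AllPairs using (AllPairs; []; _∷_)
import Data.List.Relation.Unary.AllPairs.Properties as AllPairs
open import Data.List.Relation.Unary.Any using (here; there; index)
open import Data.List.Relation.Unary.Any.Properties using () renaming (lookup-index to lookup-indexˡ)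
open import Data.List.Relation.Unary.Unique.Propositional using (Unique)
open import Data.Nat.Base using
  (ℕ; zero; suc; _+_; _*_; _^_; _∸_; _⊓_; _⊔_; _%_; _≤_; _<_; z≤n; s≤s; s≤s⁻¹; NonZero; >-nonZero)
open import Data.Nat.Combinatorics using (_C_; nCn≡1; nCk+nC[k+1]≡[n+1]C[k+1])
open import Data.Nat.DivMod using ([m+kn]%n≡m%n; m<n⇒m%n≡m)
import Data.Nat.Properties as ℕ
open import Data.Nat.Properties hiding (_≟_)
open import Data.Product.Base using (Σ; ∃-syntax; _×_; _,_; proj₁; proj₂)
open import Data.Sum.Base using (_⊎_; inj₁; inj₂; [_,_]′)
open import Data.Vec.Base using (Vec; []; _∷_; lookup; replicate; tabulate; _[_]≔_)
open import Data.Vec.Membership.Propositional using () renaming (_∈_ to _∈ᵛ_)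
open import Data.Vec.Properties using (lookup∘tabulate; tabulate-cong; []=⇒lookup; lookup⇒[]=)
import Data.Vec.Relation.Unary.Any as Anyᵛ
open import Data.Vec.Relation.Unary.Any using (here; there)
open import Data.Vec.Relation.Unary.Any.Properties using (lookup-index)
open import Function.Base using (_∘_; id; case_of_)
open import Function.Definitions using (Injective)
open import Relation.Binary.Construct.Closure.ReflexiveTransitive using (Star; ε; _◅_; _◅◅_; gmap)
open import Relation.Binary.Definitions using (tri<; tri≈; tri>)
open import Relation.Binary.PropositionalEquality
open import Relation.Nullary.Decidable using (dec-true)
open import Relation.Nullary.Decidable.Core using (does; yes; no; _×-dec_; ¬?)
open import Relation.Nullary.Negation.Core using (¬_)

-- A total typed language

infixr 6 _⊗_
infix  4 _∋_ _⊩_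

-- There is no type of numbers. Colours are stored as vertices, which suffices because a free colour
-- is always found below `n`.
data Ty : Set where
  bool vtx : Ty
  tbl      : Ty → Ty
  _⊗_      : Ty → Ty → Ty

Ctx : Set
Ctx = List Ty

data _∋_ : Ctx → Ty → Set where
  top : ∀ {Γ τ} → (τ ∷ Γ) ∋ τ
  pop : ∀ {Γ τ σ} → Γ ∋ τ → (σ ∷ Γ) ∋ τ

-- The number of iterations of a fold: n or min (p, n).
data Range : Set where
  order radius : Range

-- `call` evaluates its arguments into a fresh environment. A term over a small context is thus
-- reused in any other context without renaming, and a `call` that passes on the context with one
-- more argument acts as a let.
data _⊩_ : Ctx → Ty → Set where
  var   : ∀ {Γ τ} → Γ ∋ τ → Γ ⊩ τ
  ff tt : ∀ {Γ} → Γ ⊩ bool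
  ite   : ∀ {Γ τ} → Γ ⊩ bool → Γ ⊩ τ → Γ ⊩ τ → Γ ⊩ τ
  eqᵛ   : ∀ {Γ} → Γ ⊩ vtx → Γ ⊩ vtx → Γ ⊩ bool
  tab   : ∀ {Γ τ} → (vtx ∷ Γ) ⊩ τ → Γ ⊩ tbl τ
  nth   : ∀ {Γ τ} → Γ ⊩ tbl τ → Γ ⊩ vtx → Γ ⊩ τ
  fold  : ∀ {Γ τ} → Range → Γ ⊩ τ → (vtx ∷ τ ∷ Γ) ⊩ τ → Γ ⊩ τ
  pair  : ∀ {Γ σ τ} → Γ ⊩ σ → Γ ⊩ τ → Γ ⊩ σ ⊗ τ
  fst   : ∀ {Γ σ τ} → Γ ⊩ σ ⊗ τ → Γ ⊩ σ
  snd   : ∀ {Γ σ τ} → Γ ⊩ σ ⊗ τ → Γ ⊩ τ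
  call  : ∀ {Γ Δ τ} → Δ ⊩ τ → All (Γ ⊩_) Δ → Γ ⊩ τ

Val : ℕ → Ty → Set
Val n bool    = Bool
Val n vtx     = Fin n
Val n (tbl τ) = Fin n → Val n τ
Val n (σ ⊗ τ) = Val n σ × Val n τ

Env : ℕ → Ctx → Set
Env n = All (Val n)

get : ∀ {n Γ τ} → Γ ∋ τ → Env n Γ → Val n τ
get top     (a ∷ ρ) = a
get (pop x) (a ∷ ρ) = get x ρ

-- The indices run downwards because the compiled loop takes its unary counter, already decremented,
-- as the index.
foldFin : ∀ {A : Set} m → (Fin m → A → A) → A → A
foldFin zero    f a = a
foldFin (suc m) f a = foldFin m (f ∘ inject₁) (f (fromℕ m) a)

module _ {n q : ℕ} (q≤n : q ≤ n) where

  mutual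
    eval⟨_⟩ : ∀ {Γ τ} → Γ ⊩ τ → Env n Γ → Val n τ
    eval⟨ var x ⟩           ρ = get x ρ
    eval⟨ ff ⟩              ρ = false
    eval⟨ tt ⟩              ρ = true
    eval⟨ ite c a b ⟩       ρ = if eval⟨ c ⟩ ρ then eval⟨ a ⟩ ρ else eval⟨ b ⟩ ρ
    eval⟨ eqᵛ a b ⟩         ρ = does (eval⟨ a ⟩ ρ ≟ eval⟨ b ⟩ ρ)
    eval⟨ tab f ⟩           ρ = λ i → eval⟨ f ⟩ (i ∷ ρ)
    eval⟨ nth a b ⟩         ρ = eval⟨ a ⟩ ρ (eval⟨ b ⟩ ρ)
    eval⟨ fold order a f ⟩  ρ = foldFin n (λ i x → eval⟨ f ⟩ (i ∷ x ∷ ρ)) (eval⟨ a ⟩ ρ)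
    eval⟨ fold radius a f ⟩ ρ = foldFin q (λ i x → eval⟨ f ⟩ (inject≤ i q≤n ∷ x ∷ ρ)) (eval⟨ a ⟩ ρ)
    eval⟨ pair a b ⟩        ρ = eval⟨ a ⟩ ρ , eval⟨ b ⟩ ρ
    eval⟨ fst a ⟩           ρ = proj₁ (eval⟨ a ⟩ ρ)
    eval⟨ snd a ⟩           ρ = proj₂ (eval⟨ a ⟩ ρ)
    eval⟨ call t as ⟩       ρ = eval⟨ t ⟩ (evals as ρ)

    evals : ∀ {Γ Δ} → All (Γ ⊩_) Δ → Env n Γ → Env n Δ
    evals []       ρ = []
    evals (a ∷ as) ρ = eval⟨ a ⟩ ρ ∷ evals as ρ

-- Compilation to WHILE

-- The value just computed, the environment, n and min (p, n) in unary, and a stack.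
pattern V = 0F
pattern E = 1F
pattern N = 2F
pattern Q = 3F
pattern T = 4F

encode : ∀ {n} τ → Val n τ → Data
encode bool    b       = encodeBool b
encode vtx     i       = encodeℕ (toℕ i)
encode (tbl τ) f       = encodeList (List.tabulate (encode τ ∘ f))
encode (σ ⊗ τ) (a , b) = encode σ a ∙ encode τ b

encodeEnv : ∀ {n Γ} → Env n Γ → Data
encodeEnv []            = nil
encodeEnv (_∷_ {τ} a ρ) = encode τ a ∙ encodeEnv ρ

reg : Fin 5 → Expr 5
reg = var

tail : ∀ {Γ τ} → Γ ∋ τ → Expr 5
tail top     = reg E
tail (pop x) = tlᵉ (tail x)

limit : Range → Fin 5
limit order  = N
limit radius = Q

mutual
  compile : ∀ {Γ τ} → Γ ⊩ τ → Cmd 5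
  compile (var x)    = V ≔ hdᵉ (tail x)
  compile ff         = V ≔ nilᵉ
  compile tt         = V ≔ nilᵉ ∙ᵉ nilᵉ
  compile (ite c a b) = compile c ⨾ ifᵉ reg V then compile a else compile b
  compile (eqᵛ a b)   =
    compile a ⨾ T ≔ reg V ∙ᵉ reg T ⨾ compile b ⨾
    while reg V loop
      (ifᵉ hdᵉ (reg T)
       then (V ≔ tlᵉ (reg V) ⨾ T ≔ tlᵉ (hdᵉ (reg T)) ∙ᵉ tlᵉ (reg T))
       -- If the second number is the larger one, the loop is ended with a pair on top of the stack.
       -- Afterwards the top is `nil` exactly if the numbers agree.
       else (V ≔ nilᵉ ⨾ T ≔ (nilᵉ ∙ᵉ nilᵉ) ∙ᵉ tlᵉ (reg T))) ⨾
    ifᵉ hdᵉ (reg T) then V ≔ nilᵉ else (V ≔ nilᵉ ∙ᵉ nilᵉ) ⨾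
    T ≔ tlᵉ (reg T)
  compile (tab f) =
    -- The counter lies above the list built so far. As the indices run downwards, consing the
    -- entries leaves them in increasing order.
    T ≔ reg N ∙ᵉ nilᵉ ∙ᵉ reg T ⨾
    while hdᵉ (reg T) loop
      (T ≔ tlᵉ (hdᵉ (reg T)) ∙ᵉ tlᵉ (reg T) ⨾
       E ≔ hdᵉ (reg T) ∙ᵉ reg E ⨾
       compile f ⨾
       E ≔ tlᵉ (reg E) ⨾
       T ≔ hdᵉ (reg T) ∙ᵉ (reg V ∙ᵉ hdᵉ (tlᵉ (reg T))) ∙ᵉ tlᵉ (tlᵉ (reg T))) ⨾
    V ≔ hdᵉ (tlᵉ (reg T)) ⨾
    T ≔ tlᵉ (tlᵉ (reg T))
  compile (nth a b) =
    compile a ⨾ T ≔ reg V ∙ᵉ reg T ⨾ compile b ⨾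
    while reg V loop (V ≔ tlᵉ (reg V) ⨾ T ≔ tlᵉ (hdᵉ (reg T)) ∙ᵉ tlᵉ (reg T)) ⨾
    V ≔ hdᵉ (hdᵉ (reg T)) ⨾
    T ≔ tlᵉ (reg T)
  compile (fold r a f) =
    compile a ⨾ T ≔ reg (limit r) ∙ᵉ reg T ⨾
    while hdᵉ (reg T) loop
      (T ≔ tlᵉ (hdᵉ (reg T)) ∙ᵉ tlᵉ (reg T) ⨾
       E ≔ hdᵉ (reg T) ∙ᵉ reg V ∙ᵉ reg E ⨾
       compile f ⨾
       E ≔ tlᵉ (tlᵉ (reg E))) ⨾
    T ≔ tlᵉ (reg T)
  compile (pair a b) =
    compile a ⨾ T ≔ reg V ∙ᵉ reg T ⨾ compile b ⨾ V ≔ hdᵉ (reg T) ∙ᵉ reg V ⨾ T ≔ tlᵉ (reg T)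
  compile (fst a) = compile a ⨾ V ≔ hdᵉ (reg V)
  compile (snd a) = compile a ⨾ V ≔ tlᵉ (reg V)
  compile (call t as) =
    compiles as ⨾
    T ≔ hdᵉ (reg T) ∙ᵉ reg E ∙ᵉ tlᵉ (reg T) ⨾
    E ≔ hdᵉ (reg T) ⨾
    T ≔ tlᵉ (reg T) ⨾
    compile t ⨾
    E ≔ hdᵉ (reg T) ⨾
    T ≔ tlᵉ (reg T)

  compiles : ∀ {Γ Δ} → All (Γ ⊩_) Δ → Cmd 5
  compiles []       = T ≔ nilᵉ ∙ᵉ reg T
  compiles (a ∷ as) = compiles as ⨾ compile a ⨾ T ≔ (reg V ∙ᵉ hdᵉ (reg T)) ∙ᵉ tlᵉ (reg T)

-- Execution within a time bound

infix 2 _⊢_⇓≤[_]_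

_⊢_⇓≤[_]_ : ∀ {m} → Store m → Cmd m → ℕ → Store m → Set
σ ⊢ c ⇓≤[ b ] τ = ∃[ t ] ((σ ⊢ c ⇓[ t ] τ) × t ≤ b)

module _ {m : ℕ} where

  private variable
    σ τ υ : Store m
    c d : Cmd m
    e : Expr m
    x : Fin m
    i j : ℕ
    h k : Data

  assign≤ : σ ⊢ x ≔ e ⇓≤[ suc (cost e) ] (σ [ x ]≔ eval e σ)
  assign≤ = _ , assign , ≤-refl

  infixr 3 _⟫_
  _⟫_ : σ ⊢ c ⇓≤[ i ] τ → τ ⊢ d ⇓≤[ j ] υ → σ ⊢ c ⨾ d ⇓≤[ i + j ] υ
  (_ , r , p) ⟫ (_ , s , q) = _ , seq r s , +-mono-≤ p q

  weaken : i ≤ j → σ ⊢ c ⇓≤[ i ] τ → σ ⊢ c ⇓≤[ j ] τ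
  weaken le (_ , r , p) = _ , r , ≤-trans p le

  -- Either branch is charged for both, so that the bound of a conditional does not depend on the
  -- outcome of the test.
  then≤ : eval e σ ≡ h ∙ k → σ ⊢ c ⇓≤[ i ] τ → σ ⊢ ifᵉ e then c else d ⇓≤[ suc (cost e) + (i + j) ] τ
  then≤ {e = e} {j = j} eq (_ , r , p) = _ , if-true eq r ,
    s≤s (+-monoʳ-≤ (cost e) (≤-trans p (m≤m+n _ j)))

  else≤ : eval e σ ≡ nil → σ ⊢ d ⇓≤[ j ] τ → σ ⊢ ifᵉ e then c else d ⇓≤[ suc (cost e) + (i + j) ] τ
  else≤ {e = e} {i = i} eq (_ , r , p) = _ , if-false eq r ,
    s≤s (+-monoʳ-≤ (cost e) (≤-trans p (m≤n+m _ i)))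

  while-stop : eval e σ ≡ nil → σ ⊢ while e loop c ⇓≤[ suc (cost e) ] σ
  while-stop eq = _ , while-false eq , ≤-refl

  -- Here `l` is the number of iterations still to come and `j` the cost of the failing last test.
  -- Loops can then be treated by induction on their counter without further arithmetic.
  while-step : ∀ l → eval e σ ≡ h ∙ k → σ ⊢ c ⇓≤[ i ] τ →
    τ ⊢ while e loop c ⇓≤[ l * (suc (cost e) + i) + j ] υ →
    σ ⊢ while e loop c ⇓≤[ suc l * (suc (cost e) + i) + j ] υ
  while-step {e = e} {i = i} {j = j} l eq (_ , r , p) (_ , s , q) = _ , while-true eq r s , (begin
    suc (cost e + _)                                ≤⟨ s≤s (+-monoʳ-≤ (cost e) (+-mono-≤ p q)) ⟩
    suc (cost e + (i + (l * step + j)))             ≡⟨ cong suc (+-assoc (cost e) i _) ⟨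
    step + (l * step + j)                           ≡⟨ +-assoc step _ j ⟨
    suc l * step + j                                ∎)
    where
    open ≤-Reasoning
    step = suc (cost e) + i

mutual
  -- The summands follow the commands of `compile` one by one and are left unsimplified, so that
  -- composing bounds yields these expressions by computation.
  time : ∀ {Γ τ} → Γ ⊩ τ → ℕ → ℕ
  time (var x)      n = suc (cost (hdᵉ (tail x)))
  time ff           n = 2
  time tt           n = 4
  time (ite c a b)  n = time c n + (2 + (time a n + time b n))
  -- An iteration takes 2 for the loop test, 3 for the inner test and 10 + 9 for its two branches.
  time (eqᵛ a b)     n = time a n + (4 + (time b n + ((n * 24 + 2) + (9 + 3))))
  time (tab f)      n = 6 + ((n * (3 + (7 + (5 + (time f n + (3 + 13))))) + 3) + (4 + 4))
  time (nth a b)    n = time a n + (4 + (time b n + ((n * (2 + (3 + 7)) + 2) + (4 + 3))))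
  time (fold r a f) n = time a n + (4 + ((n * (3 + (7 + (7 + (time f n + 4)))) + 3) + 3))
  time (pair a b)   n = time a n + (4 + (time b n + (5 + 3)))
  time (fst a)      n = time a n + 3
  time (snd a)      n = time a n + 3
  time (call t as)  n = times as n + (8 + (3 + (3 + (time t n + (3 + 3)))))

  times : ∀ {Γ Δ} → All (Γ ⊩_) Δ → ℕ → ℕ
  times []       n = 4
  times (a ∷ as) n = times as n + (time a n + 8)

-- Correctness of the compiler

module Correct {n q : ℕ} (q≤n : q ≤ n) where

  st : Data → Data → Data → Store 5
  st a e s = a ∷ e ∷ encodeℕ n ∷ encodeℕ q ∷ s ∷ []

  nth-run : ∀ {m} (f : Fin m → Data) (i : Fin m) {d e s} →
    ∃[ d′ ] (hd d′ ≡ f i ×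
    (st (encodeℕ (toℕ i)) e (List.foldr _∙_ d (List.tabulate f) ∙ s)
      ⊢ while reg V loop (V ≔ tlᵉ (reg V) ⨾ T ≔ tlᵉ (hdᵉ (reg T)) ∙ᵉ tlᵉ (reg T))
      ⇓≤[ toℕ i * (2 + (3 + 7)) + 2 ] st nil e (d′ ∙ s)))
  nth-run f zero    = _ , refl , while-stop refl
  nth-run f (suc i) =
    let d , eq , r = nth-run (f ∘ suc) i
    in d , eq , while-step (toℕ i) refl (assign≤ ⟫ assign≤) r

  eqLoop : Cmd 5
  eqLoop =
    while reg V loop
      (ifᵉ hdᵉ (reg T)
       then (V ≔ tlᵉ (reg V) ⨾ T ≔ tlᵉ (hdᵉ (reg T)) ∙ᵉ tlᵉ (reg T))
       else (V ≔ nilᵉ ⨾ T ≔ (nilᵉ ∙ᵉ nilᵉ) ∙ᵉ tlᵉ (reg T)))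

  eq-run : ∀ i j {e s} → ∃[ d ]
    ((st (encodeℕ j) e (encodeℕ i ∙ s) ⊢ eqLoop ⇓≤[ j * 24 + 2 ] st nil e (d ∙ s))
     × (i ≡ j → d ≡ nil) × (i ≢ j → ∃[ h ] ∃[ k ] d ≡ h ∙ k))
  eq-run zero    zero    = _ , while-stop refl , (λ _ → refl) , λ i≢j → ⊥-elim (i≢j refl)
  eq-run (suc i) zero    = _ , while-stop refl , (λ ()) , λ _ → _ , _ , refl
  eq-run zero    (suc j) = _ ,
    weaken (+-monoʳ-≤ 24 (m≤n+m 2 (j * 24))) (while-step 0 refl (else≤ {i = 10} refl (assign≤ ⟫ assign≤)) (while-stop refl)) ,
    (λ ()) , λ _ → _ , _ , refl
  eq-run (suc i) (suc j) =
    let d , r , p , q = eq-run i j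
    in d , while-step j refl (then≤ {j = 9} refl (assign≤ ⟫ assign≤)) r ,
       (λ { refl → p refl }) , λ i≢j → q (i≢j ∘ cong suc)

  fold-body : Cmd 5 → Cmd 5
  fold-body c =
    T ≔ tlᵉ (hdᵉ (reg T)) ∙ᵉ tlᵉ (reg T) ⨾ E ≔ hdᵉ (reg T) ∙ᵉ reg V ∙ᵉ reg E ⨾ c ⨾ E ≔ tlᵉ (tlᵉ (reg E))

  fold-run : ∀ {A : Set} (enc : A → Data) (c : Cmd 5) {e b} m (f : Fin m → A → A) →
    (∀ i a {s} → st (enc a) (encodeℕ (toℕ i) ∙ enc a ∙ e) s ⊢ c ⇓≤[ b ]
                 st (enc (f i a)) (encodeℕ (toℕ i) ∙ enc a ∙ e) s) →
    ∀ a {s} → st (enc a) e (encodeℕ m ∙ s) ⊢ while hdᵉ (reg T) loop fold-body c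
              ⇓≤[ m * (3 + (7 + (7 + (b + 4)))) + 3 ] st (enc (foldFin m f a)) e (nil ∙ s)
  fold-run enc c zero    f h a = while-stop refl
  fold-run enc c {e} {b} (suc m) f h a = while-step m refl (assign≤ ⟫ assign≤ ⟫ first ⟫ assign≤)
    (fold-run enc c m (f ∘ inject₁) (λ i a {s} → subst
      (λ j → st (enc a) (encodeℕ j ∙ enc a ∙ e) s ⊢ c ⇓≤[ b ]
             st (enc (f (inject₁ i) a)) (encodeℕ j ∙ enc a ∙ e) s)
      (toℕ-inject₁ i) (h (inject₁ i) a)) (f (fromℕ m) a))
    where
    first : ∀ {s} → st (enc a) (encodeℕ m ∙ enc a ∙ e) s ⊢ c ⇓≤[ b ]
                    st (enc (f (fromℕ m) a)) (encodeℕ m ∙ enc a ∙ e) s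
    first {s} = subst
      (λ j → st (enc a) (encodeℕ j ∙ enc a ∙ e) s ⊢ c ⇓≤[ b ]
             st (enc (f (fromℕ m) a)) (encodeℕ j ∙ enc a ∙ e) s)
      (toℕ-fromℕ m) (h (fromℕ m) a)

  -- The loop of `tab` computes the last entry first and puts it in front of the list `d` built so
  -- far.
  foldr-tabulate-last : ∀ m (f : Fin (suc m) → Data) d →
    List.foldr _∙_ d (List.tabulate f) ≡ List.foldr _∙_ (f (fromℕ m) ∙ d) (List.tabulate (f ∘ inject₁))
  foldr-tabulate-last zero    f d = refl
  foldr-tabulate-last (suc m) f d = cong (f zero ∙_) (foldr-tabulate-last m (f ∘ suc) d)

  tab-body : Cmd 5 → Cmd 5
  tab-body c =
    T ≔ tlᵉ (hdᵉ (reg T)) ∙ᵉ tlᵉ (reg T) ⨾ E ≔ hdᵉ (reg T) ∙ᵉ reg E ⨾ c ⨾ E ≔ tlᵉ (reg E) ⨾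
    T ≔ hdᵉ (reg T) ∙ᵉ (reg V ∙ᵉ hdᵉ (tlᵉ (reg T))) ∙ᵉ tlᵉ (tlᵉ (reg T))

  tab-run : ∀ (c : Cmd 5) {e b} m (f : Fin m → Data) →
    (∀ i {d s} → st d (encodeℕ (toℕ i) ∙ e) s ⊢ c ⇓≤[ b ] st (f i) (encodeℕ (toℕ i) ∙ e) s) →
    ∀ {d₀ d s} → ∃[ d₁ ] (st d₀ e (encodeℕ m ∙ d ∙ s) ⊢ while hdᵉ (reg T) loop tab-body c
              ⇓≤[ m * (3 + (7 + (5 + (b + (3 + 13))))) + 3 ]
              st d₁ e (nil ∙ List.foldr _∙_ d (List.tabulate f) ∙ s))
  tab-run c zero    f h = _ , while-stop refl
  tab-run c {e} {b} (suc m) f h {d₀} {d} {s} =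
    let d₁ , r = tab-run c m (f ∘ inject₁) (λ i {d} {s} → subst
                   (λ j → st d (encodeℕ j ∙ e) s ⊢ c ⇓≤[ b ] st (f (inject₁ i)) (encodeℕ j ∙ e) s)
                   (toℕ-inject₁ i) (h (inject₁ i)))
    in d₁ , while-step m refl (assign≤ ⟫ assign≤ ⟫ first ⟫ assign≤ ⟫ assign≤)
      (subst (λ x → st (f (fromℕ m)) e (encodeℕ m ∙ (f (fromℕ m) ∙ d) ∙ s) ⊢ while hdᵉ (reg T) loop tab-body c
         ⇓≤[ m * (3 + (7 + (5 + (b + (3 + 13))))) + 3 ] st d₁ e (nil ∙ x ∙ s)) (sym (foldr-tabulate-last m f d)) r)
    where
    first : ∀ {d s} → st d (encodeℕ m ∙ e) s ⊢ c ⇓≤[ b ] st (f (fromℕ m)) (encodeℕ m ∙ e) s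
    first {d} {s} = subst
      (λ j → st d (encodeℕ j ∙ e) s ⊢ c ⇓≤[ b ] st (f (fromℕ m)) (encodeℕ j ∙ e) s)
      (toℕ-fromℕ m) (h (fromℕ m))

  eqᵛ-run : ∀ (i j : Fin n) {e s} →
    st (encodeℕ (toℕ j)) e (encodeℕ (toℕ i) ∙ s)
      ⊢ eqLoop ⨾ ifᵉ hdᵉ (reg T) then V ≔ nilᵉ else (V ≔ nilᵉ ∙ᵉ nilᵉ) ⨾ T ≔ tlᵉ (reg T)
      ⇓≤[ (n * 24 + 2) + (9 + 3) ] st (encodeBool (does (i ≟ j))) e s
  eqᵛ-run i j with eq-run (toℕ i) (toℕ j) | i ≟ j
  ... | d , r , p , _ | yes i≡j =
    weaken (+-monoˡ-≤ 2 (*-monoˡ-≤ 24 (<⇒≤ (toℕ<n j)))) r ⟫ else≤ {i = 2} (p (cong toℕ i≡j)) assign≤ ⟫ assign≤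
  ... | d , r , _ , p | no i≢j with p (i≢j ∘ toℕ-injective)
  ... | h , k , refl =
    weaken (+-monoˡ-≤ 2 (*-monoˡ-≤ 24 (<⇒≤ (toℕ<n j)))) r ⟫ then≤ {j = 4} refl assign≤ ⟫ assign≤

  -- The expression `tail x` always starts from the whole of `E`, while the induction shortens the
  -- environment. The traversal is therefore also given as a function `drop` of the contents of `E`,
  -- which commutes with `tl`.
  tail-correct : ∀ {Γ τ} (x : Γ ∋ τ) (ρ : Env n Γ) {d s} →
    hd (eval (tail x) (st d (encodeEnv ρ) s)) ≡ encode τ (get x ρ)
  tail-correct x ρ {d} {s} = go x ρ refl
    where
    drop : ∀ {Γ τ} → Γ ∋ τ → Data → Data
    drop top     e = e
    drop (pop x) e = tl (drop x e)

    drop-tl : ∀ {Γ τ} (x : Γ ∋ τ) e → tl (drop x e) ≡ drop x (tl e)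
    drop-tl top     e = refl
    drop-tl (pop x) e = cong tl (drop-tl x e)

    eval-tail : ∀ {Γ τ} (x : Γ ∋ τ) {e} → eval (tail x) (st d e s) ≡ drop x e
    eval-tail top     = refl
    eval-tail (pop x) = cong tl (eval-tail x)

    go : ∀ {Γ τ} (x : Γ ∋ τ) (ρ : Env n Γ) {e} → e ≡ encodeEnv ρ →
         hd (eval (tail x) (st d e s)) ≡ encode τ (get x ρ)
    go top     (a ∷ ρ) refl = refl
    go (pop x) (a ∷ ρ) refl = trans (cong hd (trans (cong tl (eval-tail x)) (trans (drop-tl x _) (sym (eval-tail x)))))
                              (go x ρ refl)

  mutual
    run : ∀ {Γ τ} (t : Γ ⊩ τ) (ρ : Env n Γ) {d s} →
      st d (encodeEnv ρ) s ⊢ compile t ⇓≤[ time t n ] st (encode τ (eval⟨_⟩ q≤n t ρ)) (encodeEnv ρ) s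
    run (var x) ρ {d} {s} = subst (λ a → _ ⊢ _ ⇓≤[ _ ] st a (encodeEnv ρ) s) (tail-correct x ρ {d} {s}) assign≤
    run ff ρ = assign≤
    run tt ρ = assign≤
    run (ite c a b) ρ {d} {s} with eval⟨_⟩ q≤n c ρ | run c ρ {d} {s}
    ... | true  | r = r ⟫ then≤ refl (run a ρ)
    ... | false | r = r ⟫ else≤ refl (run b ρ)
    run (eqᵛ a b) ρ = run a ρ ⟫ assign≤ ⟫ run b ρ ⟫ eqᵛ-run (eval⟨_⟩ q≤n a ρ) (eval⟨_⟩ q≤n b ρ)
    run (tab f) ρ = assign≤ ⟫ proj₂ (tab-run (compile f) n _ (λ i → run f (i ∷ ρ))) ⟫ assign≤ ⟫ assign≤
    run (nth a b) ρ {s = s} =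
      let i = eval⟨_⟩ q≤n b ρ
          d , d≡ , r = nth-run (encode _ ∘ eval⟨_⟩ q≤n a ρ) i
      in run a ρ ⟫ assign≤ ⟫ run b ρ ⟫
         weaken (+-monoˡ-≤ 2 (*-monoˡ-≤ 12 (<⇒≤ (toℕ<n i)))) r ⟫
         subst (λ x → st nil (encodeEnv ρ) (d ∙ s) ⊢ V ≔ hdᵉ (hdᵉ (reg T)) ⇓≤[ 4 ] st x (encodeEnv ρ) (d ∙ s)) d≡ assign≤ ⟫
         assign≤
    run (fold order a f) ρ =
      run a ρ ⟫ assign≤ ⟫ fold-run (encode _) (compile f) n _ (λ i x → run f (i ∷ x ∷ ρ)) _ ⟫ assign≤
    run (fold radius a f) ρ =
      run a ρ ⟫ assign≤ ⟫
      -- The loop runs `q` times but is charged for `n` iterations, which keeps the bound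
      -- independent of `p`.
      weaken (+-monoˡ-≤ 3 (*-monoˡ-≤ _ q≤n)) (fold-run (encode _) (compile f) q _
        (λ i x {s} → subst
          (λ j → st (encode _ x) (encodeℕ j ∙ encode _ x ∙ encodeEnv ρ) s ⊢ compile f ⇓≤[ _ ]
                 st (encode _ (eval⟨_⟩ q≤n f (inject≤ i q≤n ∷ x ∷ ρ))) (encodeℕ j ∙ encode _ x ∙ encodeEnv ρ) s)
          (toℕ-inject≤ i q≤n) (run f (inject≤ i q≤n ∷ x ∷ ρ))) _) ⟫
      assign≤
    run (pair a b) ρ = run a ρ ⟫ assign≤ ⟫ run b ρ ⟫ assign≤ ⟫ assign≤
    run (fst a) ρ = run a ρ ⟫ assign≤
    run (snd a) ρ = run a ρ ⟫ assign≤
    run (call t as) ρ =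
      proj₂ (runs as ρ) ⟫ assign≤ ⟫ assign≤ ⟫ assign≤ ⟫ run t (evals q≤n as ρ) ⟫ assign≤ ⟫ assign≤

    runs : ∀ {Γ Δ} (as : All (Γ ⊩_) Δ) (ρ : Env n Γ) {d s} → ∃[ d′ ]
      (st d (encodeEnv ρ) s ⊢ compiles as ⇓≤[ times as n ] st d′ (encodeEnv ρ) (encodeEnv (evals q≤n as ρ) ∙ s))
    runs []       ρ = _ , assign≤
    runs (a ∷ as) ρ = _ , (proj₂ (runs as ρ) ⟫ run a ρ ⟫ assign≤)

-- Polynomial bounds on the running time

-- The base `suc n` is positive, so raising the exponent never lowers the bound; `poly-1⊔` passes to
-- the base `1 ⊔ n` in the end.
Poly : (ℕ → ℕ) → Set
Poly f = ∃[ c ] (∀ n → f n ≤ c * suc n ^ c)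

poly-const : ∀ a → Poly (λ _ → a)
poly-const a = a , λ n → m≤m*n a (suc n ^ a) ⦃ m^n≢0 (suc n) a ⦄

poly-+ : ∀ {f g} → Poly f → Poly g → Poly (λ n → f n + g n)
poly-+ {f} {g} (c , p) (d , q) = c + d , λ n → begin
  f n + g n                                       ≤⟨ +-mono-≤ (p n) (q n) ⟩
  c * suc n ^ c + d * suc n ^ d                   ≤⟨ +-mono-≤ (*-monoʳ-≤ c (^-monoʳ-≤ (suc n) (m≤m+n c d)))
                                                              (*-monoʳ-≤ d (^-monoʳ-≤ (suc n) (m≤n+m d c))) ⟩
  c * suc n ^ (c + d) + d * suc n ^ (c + d)       ≡⟨ *-distribʳ-+ (suc n ^ (c + d)) c d ⟨
  (c + d) * suc n ^ (c + d)                       ∎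
  where open ≤-Reasoning

poly-n* : ∀ {f} → Poly f → Poly (λ n → n * f n)
poly-n* {f} (c , p) = suc c , λ n → begin
  n * f n                       ≤⟨ *-mono-≤ (n≤1+n n) (p n) ⟩
  suc n * (c * suc n ^ c)       ≡⟨ *-assoc (suc n) c _ ⟨
  suc n * c * suc n ^ c         ≡⟨ cong (_* suc n ^ c) (*-comm (suc n) c) ⟩
  c * suc n * suc n ^ c         ≡⟨ *-assoc c (suc n) _ ⟩
  c * suc n ^ suc c             ≤⟨ *-monoˡ-≤ (suc n ^ suc c) (n≤1+n c) ⟩
  suc c * suc n ^ suc c         ∎
  where open ≤-Reasoning

infixr 5 _⊕_
_⊕_ : ∀ {f} a → Poly f → Poly (λ n → a + f n)
a ⊕ p = poly-+ (poly-const a) p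

_⊕′_ : ∀ {f} → Poly f → ∀ a → Poly (λ n → f n + a)
p ⊕′ a = poly-+ p (poly-const a)

mutual
  -- The constant is read off the term, and the term of the algorithm depends on `k` only.
  time-poly : ∀ {Γ τ} (t : Γ ⊩ τ) → Poly (time t)
  time-poly (var x)      = poly-const _
  time-poly ff           = poly-const _
  time-poly tt           = poly-const _
  time-poly (ite c a b)  = poly-+ (time-poly c) (2 ⊕ poly-+ (time-poly a) (time-poly b))
  time-poly (eqᵛ a b)    =
    poly-+ (time-poly a) (4 ⊕ poly-+ (time-poly b) ((poly-n* (poly-const 24) ⊕′ 2) ⊕′ 12))
  time-poly (tab f)      = 6 ⊕ (poly-n* (3 ⊕ 7 ⊕ 5 ⊕ (time-poly f ⊕′ 16)) ⊕′ 3) ⊕′ 8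
  time-poly (nth a b)    =
    poly-+ (time-poly a) (4 ⊕ poly-+ (time-poly b) ((poly-n* (poly-const 12) ⊕′ 2) ⊕′ 7))
  time-poly (fold r a f) =
    poly-+ (time-poly a) (4 ⊕ (poly-n* (3 ⊕ 7 ⊕ 7 ⊕ (time-poly f ⊕′ 4)) ⊕′ 3) ⊕′ 3)
  time-poly (pair a b)   = poly-+ (time-poly a) (4 ⊕ (time-poly b ⊕′ 8))
  time-poly (fst a)      = time-poly a ⊕′ 3
  time-poly (snd a)      = time-poly a ⊕′ 3
  time-poly (call t as)  = poly-+ (times-poly as) (8 ⊕ 3 ⊕ 3 ⊕ (time-poly t ⊕′ 6))

  times-poly : ∀ {Γ Δ} (as : All (Γ ⊩_) Δ) → Poly (times as)
  times-poly []       = poly-const 4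
  times-poly (a ∷ as) = poly-+ (times-poly as) (time-poly a ⊕′ 8)

-- Preparing the input

setup-loop : Cmd 5
setup-loop =
  while reg T loop
    (T ≔ tlᵉ (reg T) ⨾ N ≔ nilᵉ ∙ᵉ reg N ⨾
     ifᵉ hdᵉ (reg V)
     then (Q ≔ nilᵉ ∙ᵉ reg Q ⨾ V ≔ tlᵉ (hdᵉ (reg V)) ∙ᵉ tlᵉ (reg V))
     -- This assignment changes nothing: once `p` is used up, only `N` grows.
     else (V ≔ reg V))

-- The unary numbers n and min (p, n) are read off the rows of the matrix.
setup : Cmd 5
setup = E ≔ tlᵉ (reg V) ∙ᵉ nilᵉ ⨾ T ≔ tlᵉ (reg V) ⨾ setup-loop

-- The loop is driven by the rows and looks at no more than one unit of `p` per row, so its time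
-- does not depend on `p`.
setup-loop-run : ∀ (rows : List Data) p i j {g e} →
  ∃[ a ] ((encodeℕ p ∙ g) ∷ e ∷ encodeℕ i ∷ encodeℕ j ∷ encodeList rows ∷ [] ⊢ setup-loop
    ⇓≤[ List.length rows * 25 + 2 ]
    a ∷ e ∷ encodeℕ (List.length rows + i) ∷ encodeℕ (p ⊓ List.length rows + j) ∷ nil ∷ [])
setup-loop-run []         p       i j rewrite ⊓-zeroʳ p = _ , while-stop refl
setup-loop-run (r ∷ rows) zero    i j with setup-loop-run rows zero (suc i) j
... | a , run rewrite +-suc (List.length rows) i =
  a , while-step (List.length rows) refl (assign≤ ⟫ assign≤ ⟫ else≤ {i = 11} refl assign≤) run
setup-loop-run (r ∷ rows) (suc p) i j with setup-loop-run rows p (suc i) (suc j)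
... | a , run rewrite +-suc (List.length rows) i | +-suc (p ⊓ List.length rows) j =
  a , while-step (List.length rows) refl (assign≤ ⟫ assign≤ ⟫ then≤ {j = 2} refl (assign≤ ⟫ assign≤)) run

program : (tbl (tbl bool) ∷ []) ⊩ tbl vtx → Program
program t = record { locals = 4 ; body = setup ⨾ compile t }

^-distribʳ-* : ∀ k m n → (m * n) ^ k ≡ m ^ k * n ^ k
^-distribʳ-* zero    m n = refl
^-distribʳ-* (suc k) m n =
  trans (cong (m * n *_) (^-distribʳ-* k m n)) ([m*n]*[o*p]≡[m*o]*[n*p] m n (m ^ k) (n ^ k))

suc≤2*1⊔ : ∀ n → suc n ≤ 2 * (1 ⊔ n)
suc≤2*1⊔ zero    = s≤s z≤n
suc≤2*1⊔ (suc n) = s≤s (≤-trans (≤-reflexive (+-comm 1 n)) (+-monoʳ-≤ n (s≤s z≤n)))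

-- As n + 1 is at most 2 max (1, n), the change of base costs a factor `2 ^ c`. The enlarged
-- constant also serves as the exponent, which is harmless for a positive base.
poly-1⊔ : ∀ {f} → Poly f → ∃[ c ] (∀ n → f n ≤ c * (1 ⊔ n) ^ c)
poly-1⊔ {f} (c , f≤) = c * 2 ^ c , λ n → begin
  f n                               ≤⟨ f≤ n ⟩
  c * suc n ^ c                     ≤⟨ *-monoʳ-≤ c (^-monoˡ-≤ c (suc≤2*1⊔ n)) ⟩
  c * (2 * (1 ⊔ n)) ^ c             ≡⟨ cong (c *_) (^-distribʳ-* c 2 (1 ⊔ n)) ⟩
  c * (2 ^ c * (1 ⊔ n) ^ c)         ≡⟨ *-assoc c (2 ^ c) _ ⟨
  c * 2 ^ c * (1 ⊔ n) ^ c           ≤⟨ *-monoʳ-≤ (c * 2 ^ c)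
                                         (^-monoʳ-≤ (1 ⊔ n) ⦃ 1⊔≢0 n ⦄ (m≤m*n c (2 ^ c) ⦃ m^n≢0 2 c ⦄)) ⟩
  c * 2 ^ c * (1 ⊔ n) ^ (c * 2 ^ c) ∎
  where
  open ≤-Reasoning

  1⊔≢0 : ∀ n → NonZero (1 ⊔ n)
  1⊔≢0 zero    = _
  1⊔≢0 (suc n) = _

total : (tbl (tbl bool) ∷ []) ⊩ tbl vtx → ℕ → ℕ
total t n = 5 + (3 + (n * 25 + 2)) + time t n

total-poly : ∀ t → Poly (total t)
total-poly t = poly-+ (5 ⊕ 3 ⊕ (poly-n* (poly-const 25) ⊕′ 2)) (time-poly t)

program-run : ∀ (t : (tbl (tbl bool) ∷ []) ⊩ tbl vtx) p {n} (G : Graph n) →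
  ∃[ s ] ((program t ⟨ encodeℕ p ∙ encodeGraph G ⟩⇓[ s ] encode (tbl vtx) (eval⟨ m⊓n≤n p n ⟩ t (adj G ∷ [])))
          × s ≤ total t n)
program-run t p {n} G =
  let _ , r = setup-loop-run (List.tabulate rows) p 0 0
      s , exec , s≤ = (assign≤ ⟫ assign≤ ⟫ r) ⟫ compiled
  in s , (_ , exec , refl) ,
     ≤-trans s≤ (≤-reflexive (cong (λ m → 5 + (3 + (m * 25 + 2)) + time t n) (length-tabulate rows)))
  where
  rows : Fin n → Data
  rows u = encodeList (List.tabulate λ v → encodeBool (adj G u v))

  compiled : ∀ {a} →
    let m = List.length (List.tabulate rows) in
    a ∷ (encodeGraph G ∙ nil) ∷ encodeℕ (m + 0) ∷ encodeℕ (p ⊓ m + 0) ∷ nil ∷ []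
      ⊢ compile t ⇓≤[ time t n ] encode (tbl vtx) (eval⟨ m⊓n≤n p n ⟩ t (adj G ∷ [])) ∷ (encodeGraph G ∙ nil)
        ∷ encodeℕ n ∷ encodeℕ (p ⊓ n) ∷ nil ∷ []
  compiled
    rewrite length-tabulate rows
          | +-identityʳ n | +-identityʳ (p ⊓ n)
    = Correct.run (m⊓n≤n p n) t (adj G ∷ [])

-- The algorithm

x₀ : ∀ {Γ τ} → (τ ∷ Γ) ⊩ τ
x₀ = var top

x₁ : ∀ {Γ a τ} → (a ∷ τ ∷ Γ) ⊩ τ
x₁ = var (pop top)

x₂ : ∀ {Γ a b τ} → (a ∷ b ∷ τ ∷ Γ) ⊩ τ
x₂ = var (pop (pop top))

x₃ : ∀ {Γ a b c τ} → (a ∷ b ∷ c ∷ τ ∷ Γ) ⊩ τ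
x₃ = var (pop (pop (pop top)))

x₄ : ∀ {Γ a b c d τ} → (a ∷ b ∷ c ∷ d ∷ τ ∷ Γ) ⊩ τ
x₄ = var (pop (pop (pop (pop top))))

x₅ : ∀ {Γ a b c d e τ} → (a ∷ b ∷ c ∷ d ∷ e ∷ τ ∷ Γ) ⊩ τ
x₅ = var (pop (pop (pop (pop (pop top)))))

x₆ : ∀ {Γ a b c d e f τ} → (a ∷ b ∷ c ∷ d ∷ e ∷ f ∷ τ ∷ Γ) ⊩ τ
x₆ = var (pop (pop (pop (pop (pop (pop top))))))

and or : ∀ {Γ} → Γ ⊩ bool → Γ ⊩ bool → Γ ⊩ bool
and a b = ite a b ff
or a b  = ite a tt b

not : ∀ {Γ} → Γ ⊩ bool → Γ ⊩ bool
not a = ite a ff tt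

any : ∀ {Γ} → Γ ⊩ tbl bool → Γ ⊩ bool
any f = call (fold order ff (ite (nth x₂ x₀) tt x₁)) (f ∷ [])

set matrix : Ty
set    = tbl bool
matrix = tbl set

-- Warshall's algorithm for the graph induced on a set.
reach : (matrix ∷ set ∷ []) ⊩ matrix
reach = fold order
  (tab (tab (and (nth x₃ x₁) (and (nth x₃ x₀) (or (eqᵛ x₁ x₀) (nth (nth x₂ x₁) x₀))))))
  (tab (tab (or (nth (nth x₃ x₁) x₀) (and (nth (nth x₃ x₁) x₂) (nth (nth x₃ x₂) x₀)))))

-- All vertices of B but r are deleted, so a tuple whose entries all equal r stands for the empty separator.
cell : (matrix ∷ set ∷ vtx ∷ []) ⊩ set
cell = nth (call reach (x₀ ∷ tab (or (eqᵛ x₀ x₃) (not (nth x₂ x₀))) ∷ [])) x₂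

without : (set ∷ vtx ∷ []) ⊩ set
without = tab (and (nth x₁ x₀) (not (eqᵛ x₀ x₂)))

-- Subsets of Vᵏ × V, the pair (S, r) standing for the cell of r after the deletion of S.
Tuples : ℕ → Ty
Tuples zero    = set
Tuples (suc k) = tbl (Tuples k)

none : ∀ k {Γ} → Γ ⊩ Tuples k
none zero    = tab ff
none (suc k) = tab (none k)

-- Some separator S with W S r makes Y the cell of r; the entries of S are collected in B.
covered : ∀ k → (matrix ∷ set ∷ vtx ∷ Tuples k ∷ set ∷ []) ⊩ bool
covered zero    = and (nth x₃ x₂) (not (any (tab
  (ite (nth x₂ x₀) (not (nth (call cell (x₁ ∷ x₅ ∷ x₃ ∷ [])) x₀)) (nth (call cell (x₁ ∷ x₅ ∷ x₃ ∷ [])) x₀)))))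
covered (suc k) = any (tab
  (call (covered k) (x₁ ∷ x₂ ∷ x₃ ∷ nth x₄ x₀ ∷ tab (or (nth x₆ x₀) (eqᵛ x₁ x₀)) ∷ [])))

solved : ∀ k → (matrix ∷ set ∷ Tuples k ∷ []) ⊩ bool
solved k = not (any (tab (and (nth x₂ x₀) (not (call (covered k)
  (x₁ ∷ nth (call reach (x₁ ∷ x₂ ∷ [])) x₀ ∷ x₀ ∷ x₃ ∷ tab ff ∷ []))))))

-- One round of a fixed point iteration. The number `j` counts the entries of the separator still to
-- be chosen; the set in the context collects those already chosen.
improve : ∀ k j → (matrix ∷ Tuples k ∷ set ∷ []) ⊩ Tuples j
improve k zero    = tab (any (tab (and (nth (call cell (x₂ ∷ x₄ ∷ x₁ ∷ [])) x₀)
  (call (solved k) (x₂ ∷ call without (call cell (x₂ ∷ x₄ ∷ x₁ ∷ []) ∷ x₀ ∷ []) ∷ x₃ ∷ [])))))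
improve k (suc j) = tab (call (improve k j) (x₁ ∷ x₂ ∷ tab (or (nth x₄ x₀) (eqᵛ x₁ x₀)) ∷ []))

-- By `Won-improves`, round `i` settles the relevant cells with at most `i` vertices, so `n` rounds
-- suffice.
winning : ∀ k → (matrix ∷ []) ⊩ Tuples k
winning k = fold order (none k) (call (improve k k) (x₂ ∷ x₁ ∷ tab ff ∷ []))

parents : (matrix ∷ set ∷ []) ⊩ set
parents = tab (and (not (nth x₂ x₀)) (any (tab (and (nth x₃ x₀) (nth (nth x₂ x₁) x₀)))))

ancestors : (matrix ∷ matrix ∷ vtx ∷ []) ⊩ set
ancestors = fold radius (tab (eqᵛ x₀ x₃))
  (tab (or (nth x₂ x₀) (any (tab (and (nth x₃ x₀) (nth (call parents (x₄ ∷ nth x₅ x₀ ∷ [])) x₁))))))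

-- The fold runs downwards, so the last free colour it meets is the least one.
colour : (set ∷ tbl vtx ∷ vtx ∷ []) ⊩ vtx
colour = fold order x₂ (ite (any (tab (and (nth x₃ x₀) (eqᵛ (nth x₄ x₀) x₁)))) x₁ x₀)

put : ∀ {τ} → (tbl τ ∷ vtx ∷ τ ∷ []) ⊩ tbl τ
put = tab (ite (eqᵛ x₀ x₂) x₃ (nth x₁ x₀))

-- The eliminated vertices, their cells and their colours.
state : Ty
state = set ⊗ matrix ⊗ tbl vtx

-- The outer `call` stores the new cell first, since the ancestors of the vertex are computed from
-- the updated cells. Intersecting them with the old eliminated set leaves out the vertex itself.
eliminate : (matrix ∷ state ∷ vtx ∷ set ∷ []) ⊩ state
eliminate = call
  (pair (call put (fst x₁ ∷ x₂ ∷ tt ∷ []))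
  (pair x₃
        (call put (snd (snd x₁) ∷ x₂ ∷
          call colour (tab (and (nth (fst x₂) x₀) (nth (call ancestors (x₁ ∷ x₄ ∷ x₃ ∷ [])) x₀)) ∷ snd (snd x₁) ∷ x₂ ∷ []) ∷ []))))
  (x₀ ∷ x₁ ∷ x₂ ∷ call put (fst (snd x₁) ∷ x₂ ∷ x₃ ∷ []) ∷ [])

unfinished : (state ∷ []) ⊩ set
unfinished = tab (not (nth (fst x₁) x₀))

-- The table records which cells are won but not by which vertex, so the vertex is tested here as a
-- winning choice for its component.
attempt : ∀ k → (vtx ∷ state ∷ matrix ∷ Tuples k ∷ []) ⊩ state
attempt k = call
  (ite (and (nth (call unfinished (x₁ ∷ [])) x₀) (call (solved k) (x₂ ∷ call without (x₄ ∷ x₀ ∷ []) ∷ x₃ ∷ [])))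
       (call eliminate (x₂ ∷ x₁ ∷ x₀ ∷ x₄ ∷ []))
       x₁)
  (x₀ ∷ x₁ ∷ x₂ ∷ x₃ ∷ nth (call reach (x₂ ∷ call unfinished (x₁ ∷ []) ∷ [])) x₀ ∷ [])

-- For treewidth at most `k` each sweep eliminates a vertex while any is left, so `n` sweeps
-- suffice. The identity is a placeholder for the colours.
final : ∀ k → (matrix ∷ Tuples k ∷ []) ⊩ state
final k = fold order (pair (tab ff) (pair (tab (tab ff)) (tab x₀)))
  (fold order x₁ (call (attempt k) (x₀ ∷ x₁ ∷ x₄ ∷ x₅ ∷ [])))

colouring : ∀ k → (matrix ∷ []) ⊩ tbl vtx
colouring k = snd (snd (call (final k) (x₀ ∷ winning k ∷ [])))

-- Reasoning about the evaluation

foldFin-invariant : ∀ {A : Set} {m} {f : Fin m → A → A} (P : A → Set) →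
  (∀ i x → P x → P (f i x)) → ∀ a → P a → P (foldFin m f a)
foldFin-invariant {m = zero}  P step a p = p
foldFin-invariant {m = suc m} P step a p = foldFin-invariant P (step ∘ inject₁) _ (step (fromℕ m) a p)

foldFin-establishes : ∀ {A : Set} {m} {f : Fin m → A → A} (P : Fin m → A → Set) →
  (∀ i x → P i (f i x)) → (∀ i j x → P j x → P j (f i x)) → ∀ a j → P j (foldFin m f a)
foldFin-establishes {m = suc m} P new old a j with view j
... | ‵fromℕ     = foldFin-invariant (P (fromℕ m)) (λ i x → old (inject₁ i) _ x) _ (new (fromℕ m) a)
... | ‵inject₁ i = foldFin-establishes (P ∘ inject₁) (new ∘ inject₁) (λ i j → old (inject₁ i) (inject₁ j)) _ i

foldFin-count : ∀ {A : Set} {m} {f : Fin m → A → A} (P : ℕ → A → Set) →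
  (∀ i j x → P j x → P (suc j) (f i x)) → ∀ a → P 0 a → P m (foldFin m f a)
foldFin-count {A} {m} {f} P step a p = subst (λ j → P j (foldFin m f a)) (+-identityʳ m) (go m step 0 a p)
  where
  go : ∀ m {f : Fin m → A → A} → (∀ i j x → P j x → P (suc j) (f i x)) →
       ∀ j a → P j a → P (m + j) (foldFin m f a)
  go zero    step j a p = p
  go (suc m) {f} step j a p = subst (λ l → P l (foldFin (suc m) f a)) (+-suc m j)
    (go m (step ∘ inject₁) (suc j) _ (step (fromℕ m) j a p))

foldFin-monotone : ∀ {A : Set} {m} {f : Fin m → A → A} (μ : A → ℕ) →
  (∀ i x → f i x ≡ x ⊎ μ x < μ (f i x)) → ∀ x → μ x ≤ μ (foldFin m f x)
foldFin-monotone {f = f} μ grows x = foldFin-invariant (λ y → μ x ≤ μ y)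
  (λ i y le → ≤-trans le ([ (λ eq → ≤-reflexive (cong μ (sym eq))) , <⇒≤ ]′ (grows i y))) x ≤-refl

-- The steps before that of `i` either leave `x` as it is or have already raised the measure, which
-- never drops again.
foldFin-progress : ∀ {A : Set} {m} {f : Fin m → A → A} (μ : A → ℕ) →
  (∀ i x → f i x ≡ x ⊎ μ x < μ (f i x)) →
  ∀ x → (∃[ i ] μ x < μ (f i x)) → μ x < μ (foldFin m f x)
foldFin-progress {m = suc m} {f} μ grows x (i , lt) with view i
... | ‵fromℕ = <-≤-trans lt (foldFin-monotone μ (grows ∘ inject₁) _)
... | ‵inject₁ j with grows (fromℕ m) x
...   | inj₁ eq  = subst (λ y → μ x < μ (foldFin m (f ∘ inject₁) y)) (sym eq)
                     (foldFin-progress μ (grows ∘ inject₁) x (j , lt))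
...   | inj₂ lt′ = <-≤-trans lt′ (foldFin-monotone μ (grows ∘ inject₁) _)

if-and : ∀ {a b} → (if a then b else false) ≡ true → a ≡ true × b ≡ true
if-and {true} p = refl , p

and-if : ∀ {a b} → a ≡ true → b ≡ true → (if a then b else false) ≡ true
and-if refl p = p

if-or : ∀ {a b} → (if a then true else b) ≡ true → a ≡ true ⊎ b ≡ true
if-or {true}  p = inj₁ refl
if-or {false} p = inj₂ p

or-ifˡ : ∀ {a b} → a ≡ true → (if a then true else b) ≡ true
or-ifˡ refl = refl

or-ifʳ : ∀ {a b} → b ≡ true → (if a then true else b) ≡ true
or-ifʳ {a = true}  p = refl
or-ifʳ {a = false} p = p

if-not : ∀ {a} → (if a then false else true) ≡ true → ¬ (a ≡ true)
if-not {false} p ()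

not-if : ∀ {a} → ¬ (a ≡ true) → (if a then false else true) ≡ true
not-if {true}  p = ⊥-elim (p refl)
not-if {false} p = refl

≟-sound : ∀ {n} {i j : Fin n} → does (i ≟ j) ≡ true → i ≡ j
≟-sound {i = i} {j} p with i ≟ j
... | yes i≡j = i≡j

≟-complete : ∀ {n} {i j : Fin n} → i ≡ j → does (i ≟ j) ≡ true
≟-complete {i = i} {j} i≡j with i ≟ j
... | yes _   = refl
... | no i≢j = ⊥-elim (i≢j i≡j)

VSet : ℕ → Set
VSet n = Fin n → Bool

some : ∀ {n} → VSet n → Bool
some f = foldFin _ (λ i x → if f i then true else x) false

some-sound : ∀ {n} (f : VSet n) → some f ≡ true → ∃[ i ] f i ≡ true
some-sound f = foldFin-invariant (λ x → x ≡ true → ∃[ i ] f i ≡ true)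
  (λ i x h p → [ (λ q → i , q) , h ]′ (if-or p)) false (λ ())

some-complete : ∀ {n} (f : VSet n) → ∀ i → f i ≡ true → some f ≡ true
some-complete f i = foldFin-establishes (λ i x → f i ≡ true → x ≡ true)
  (λ i x p → or-ifˡ p) (λ i j x h p → or-ifʳ (h p)) false i

infix 4 _∊_ _∌_

_∊_ _∌_ : ∀ {n} → Fin n → VSet n → Set
u ∊ X = X u ≡ true
u ∌ X = ¬ (u ∊ X)

same-set : ∀ {n} {X Y : VSet n} → (∀ u → u ∊ X → u ∊ Y) → (∀ u → u ∊ Y → u ∊ X) → ∀ u → X u ≡ Y u
same-set {X = X} {Y} p q u with X u in x | Y u in y
... | true  | true  = refl
... | false | false = refl
... | true  | false = trans (sym (p u x)) y
... | false | true  = trans (sym x) (q u y)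

-- Written as the value of `without`, so that the two agree by computation.
_−_ : ∀ {n} → VSet n → Fin n → VSet n
(X − v) u = if X u then (if does (u ≟ v) then false else true) else false

−-intro : ∀ {n} (X : VSet n) v {u} → u ∊ X → u ≢ v → u ∊ X − v
−-intro X v p u≢v = and-if p (not-if (u≢v ∘ ≟-sound))

−-elim : ∀ {n} (X : VSet n) v {u} → u ∊ X − v → u ∊ X × u ≢ v
−-elim X v p = let q , r = if-and p in q , λ u≡v → if-not r (≟-complete u≡v)

-- Components, boundaries and the table of winning cells

module Algorithm {n q : ℕ} (q≤n : q ≤ n) (G : Graph n) where

  private
    a : Fin n → Fin n → Bool
    a = adj G

    a-sym : ∀ {u v} → Adj G u v → Adj G v u
    a-sym {u} {v} p = trans (symmetric G v u) p

  ⟦_⟧ : ∀ {Γ τ} → Γ ⊩ τ → Env n Γ → Val n τ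
  ⟦_⟧ = eval⟨ q≤n ⟩

  opaque
    -- Opaque, so that the fold of `reach` is unfolded only where a value of the program has to be
    -- matched.
    component : VSet n → Fin n → VSet n
    component X = ⟦ reach ⟧ (a ∷ X ∷ [])

  module _ {X : VSet n} where

    private
      -- Transitivity through the single vertex `w`. Warshall's step at `w` establishes it and the
      -- steps at other vertices preserve it, so the final relation is transitive.
      Through : Fin n → (Fin n → VSet n) → Set
      Through w R = ∀ u v → w ∊ R u → v ∊ R w → v ∊ R u

      step : Fin n → (Fin n → VSet n) → Fin n → VSet n
      step w R u v = if R u v then true else (if R u w then R w v else false)

      step-elim : ∀ w R {u v} → v ∊ step w R u → v ∊ R u ⊎ (w ∊ R u × v ∊ R w)
      step-elim w R p with if-or p
      ... | inj₁ q = inj₁ q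
      ... | inj₂ q = inj₂ (if-and q)

      step-direct : ∀ w R {u v} → v ∊ R u → v ∊ step w R u
      step-direct w R p = or-ifˡ p

      step-via : ∀ w R {u v} → w ∊ R u → v ∊ R w → v ∊ step w R u
      step-via w R {u} {v} p q = or-ifʳ {a = R u v} (and-if p q)

      base : Fin n → VSet n
      base u v = if X u then (if X v then (if does (u ≟ v) then true else a u v) else false) else false

    opaque
      unfolding component

      component-trans : ∀ {u w v} → w ∊ component X u → v ∊ component X w → v ∊ component X u
      component-trans {u} {w} {v} = foldFin-establishes {f = step} Through new old base w u v
        where
        new : ∀ w R → Through w (step w R)
        new w R u v p q with step-elim w R p | step-elim w R q
        ... | inj₁ p       | inj₁ q       = step-via w R p q
        ... | inj₁ p       | inj₂ (_ , q) = step-via w R p q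
        ... | inj₂ (p , _) | inj₁ q       = step-via w R p q
        ... | inj₂ (p , _) | inj₂ (_ , q) = step-via w R p q

        old : ∀ w x R → Through x R → Through x (step w R)
        old w x R t u v p q with step-elim w R p | step-elim w R q
        ... | inj₁ p       | inj₁ q       = step-direct w R (t u v p q)
        ... | inj₁ p       | inj₂ (q , r) = step-via w R (t u w p q) r
        ... | inj₂ (p , r) | inj₁ q       = step-via w R p (t w v r q)
        ... | inj₂ (p , _) | inj₂ (_ , q) = step-via w R p q

      private
        base⊆ : ∀ u v → v ∊ base u → v ∊ component X u
        base⊆ u v p = foldFin-invariant {f = step} (λ R → v ∊ R u) (λ w R → step-direct w R) base p

    component-refl : ∀ {u} → u ∊ X → u ∊ component X u
    component-refl {u} p = base⊆ u u (and-if p (and-if p (or-ifˡ {b = a u u} (≟-complete {i = u} refl))))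

    component-edge : ∀ {u v} → u ∊ X → v ∊ X → Adj G u v → v ∊ component X u
    component-edge {u} {v} p q e = base⊆ u v (and-if p (and-if q (or-ifʳ {a = does (u ≟ v)} e)))

    opaque
      unfolding component

      -- Pairs enter the relation only by equality, by an edge inside `X` or by composition, and
      -- each of these carries `P` along.
      component-ind : (P : Fin n → Set) → (∀ {u v} → P u → u ∊ X → v ∊ X → Adj G u v → P v) →
        ∀ {u v} → P u → v ∊ component X u → P v
      component-ind P h {u} {v} pu r = foldFin-invariant {f = step} (λ R → ∀ u v → v ∊ R u → P u → P v)
        (λ w R ih u v p pu → [ (λ q → ih u v q pu) , (λ (q , r) → ih w v r (ih u w q pu)) ]′ (step-elim w R p))
        base (λ u v p pu → let x , p = if-and p ; y , p = if-and p in
               [ (λ q → subst P (≟-sound q) pu) , h pu x y ]′ (if-or p))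
        u v r pu

      component⊆ : ∀ {u v} → v ∊ component X u → u ∊ X × v ∊ X
      component⊆ {u} {v} r = foldFin-invariant {f = step} (λ R → ∀ u v → v ∊ R u → u ∊ X × v ∊ X)
        (λ w R ih u v p → [ ih u v , (λ (q , r) → proj₁ (ih u w q) , proj₂ (ih w v r)) ]′ (step-elim w R p))
        base (λ u v p → let x , p = if-and p in x , proj₁ (if-and p)) u v r

    component-sym : ∀ {u v} → v ∊ component X u → u ∊ component X v
    component-sym {u} r = component-ind (λ v → u ∊ component X v)
      (λ p x y e → component-trans (component-edge y x (a-sym e)) p) (component-refl (proj₁ (component⊆ r))) r

    component-step : ∀ {r u v} → u ∊ component X r → v ∊ X → Adj G u v → v ∊ component X r
    component-step p y e = component-trans p (component-edge (proj₂ (component⊆ p)) y e)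

  -- On a walk from `r` inside `X` only the next vertex has to be shown to lie in `Y`, and the part
  -- walked so far may be assumed to lie in both components. Every change of the ambient set is
  -- handled in this way.
  component-⊆ : ∀ {X Y r} → (∀ {u v} → u ∊ component X r → u ∊ component Y r → v ∊ X → Adj G u v → v ∊ Y) → r ∊ Y →
    ∀ u → u ∊ component X r → u ∊ component Y r
  component-⊆ {X} {Y} {r} h y u p = proj₂ (component-ind (λ u → u ∊ component X r × u ∊ component Y r)
    (λ (p , q) x x′ e → component-step p x′ e , component-step q (h p q x′ e) e)
    (component-refl (proj₁ (component⊆ p)) , component-refl y) p)

  boundary : VSet n → VSet n
  boundary X = ⟦ parents ⟧ (a ∷ X ∷ [])

  boundary-intro : ∀ {X u v} → u ∊ X → v ∌ X → Adj G u v → v ∊ boundary X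
  boundary-intro {u = u} p q e = and-if (not-if q) (some-complete _ u (and-if p (a-sym e)))

  boundary-elim : ∀ {X v} → v ∊ boundary X → v ∌ X × ∃[ u ] (u ∊ X × Adj G u v)
  boundary-elim p = let q , r = if-and p ; u , s = some-sound _ r in let x , e = if-and s in if-not q , u , x , a-sym e

  blocked : ∀ {j} → VSet n → Vec (Fin n) j → VSet n
  blocked B []      = B
  blocked B (s ∷ S) = blocked (λ u → if B u then true else does (s ≟ u)) S

  blocked-base : ∀ {j} {B : VSet n} (S : Vec (Fin n) j) {u} → u ∊ B → u ∊ blocked B S
  blocked-base []      p = p
  blocked-base (s ∷ S) p = blocked-base S (or-ifˡ p)

  blocked-entry : ∀ {j} {B : VSet n} {S : Vec (Fin n) j} {u} → u ∈ᵛ S → u ∊ blocked B S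
  blocked-entry {B = B} {S = s ∷ S} (here refl) = blocked-base S (or-ifʳ {a = B s} (≟-complete {i = s} refl))
  blocked-entry (there p) = blocked-entry p

  blocked-elim : ∀ {j} {B : VSet n} (S : Vec (Fin n) j) {u} → u ∊ blocked B S → u ∊ B ⊎ u ∈ᵛ S
  blocked-elim []      p = inj₁ p
  blocked-elim (s ∷ S) p with blocked-elim S p
  ... | inj₂ q = inj₂ (there q)
  ... | inj₁ q with if-or q
  ...   | inj₁ r = inj₁ r
  ...   | inj₂ r = inj₂ (here (sym (≟-sound r)))

  ∅ : VSet n
  ∅ _ = false

  outside : VSet n → Fin n → VSet n
  outside B r u = if does (u ≟ r) then true else (if B u then false else true)

  cellᵛ : VSet n → Fin n → VSet n
  cellᵛ B r = component (outside B r) r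

  entry : ∀ {k} → Val n (Tuples k) → Vec (Fin n) k → VSet n
  entry W []      = W
  entry W (s ∷ S) = entry (W s) S

  Covered : ∀ {k} → VSet n → Fin n → Val n (Tuples k) → VSet n → Set
  Covered {k} Y r W B = ∃[ S ] (r ∊ entry W S × ∀ u → Y u ≡ cellᵛ (blocked B S) r u)

  private
    not-differing : ∀ {x y} → ¬ ((if x then (if y then false else true) else y) ≡ true) → x ≡ y
    not-differing {true}  {true}  p = refl
    not-differing {true}  {false} p = ⊥-elim (p refl)
    not-differing {false} {true}  p = ⊥-elim (p refl)
    not-differing {false} {false} p = refl

    not-differing⁻ : ∀ {x y} → x ≡ y → ¬ ((if x then (if y then false else true) else y) ≡ true)
    not-differing⁻ {true}  refl ()
    not-differing⁻ {false} refl ()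

  opaque
    unfolding component

    covered-sound : ∀ k {Y r W B} → ⟦ covered k ⟧ (a ∷ Y ∷ r ∷ W ∷ B ∷ []) ≡ true → Covered {k} Y r W B
    covered-sound zero p = let w , q = if-and p in
      [] , w , λ u → not-differing (λ d → if-not q (some-complete _ u d))
    covered-sound (suc k) {W = W} p =
      let s , q = some-sound _ p ; S , w , e = covered-sound k q in s ∷ S , w , e

    covered-complete : ∀ k {Y r W B} → Covered {k} Y r W B → ⟦ covered k ⟧ (a ∷ Y ∷ r ∷ W ∷ B ∷ []) ≡ true
    covered-complete zero ([] , w , e) =
      and-if w (not-if (λ p → let u , d = some-sound _ p in not-differing⁻ (e u) d))
    covered-complete (suc k) (s ∷ S , w , e) = some-complete _ s (covered-complete k (S , w , e))

  Solved : ∀ {k} → VSet n → Val n (Tuples k) → Set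
  Solved X W = ∀ r → r ∊ X → Covered (component X r) r W ∅

  solvedᵛ : ∀ k → VSet n → Val n (Tuples k) → Bool
  solvedᵛ k X W = ⟦ solved k ⟧ (a ∷ X ∷ W ∷ [])

  opaque
    unfolding component

    solved-sound : ∀ k {X W} → solvedᵛ k X W ≡ true → Solved {k} X W
    solved-sound k {X} {W} p r x
      with ⟦ covered k ⟧ (a ∷ component X r ∷ r ∷ W ∷ ∅ ∷ []) in c
    ... | true  = covered-sound k c
    ... | false = ⊥-elim (if-not p (some-complete _ r (and-if x (not-if λ c′ → case trans (sym c) c′ of λ ()))))

    solved-complete : ∀ k {X W} → Solved {k} X W → solvedᵛ k X W ≡ true
    solved-complete k h = not-if λ p → let r , q = some-sound _ p ; x , c = if-and q in
      if-not c (covered-complete k (h r x))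

  Solved-cong : ∀ {k X Y} {W : Val n (Tuples k)} → (∀ u → X u ≡ Y u) → Solved X W → Solved Y W
  Solved-cong {X = X} {Y} e h r y =
    let S , w , c = h r (trans (e r) y)
    in S , w , λ u → trans (same-set
      (component-⊆ (λ _ _ v∈Y _ → trans (e _) v∈Y) (trans (e r) y))
      (component-⊆ (λ _ _ v∈X _ → trans (sym (e _)) v∈X) y) u) (c u)

  module _ (k : ℕ) where

    improvement : Val n (Tuples k) → Val n (Tuples k)
    improvement W = ⟦ improve k k ⟧ (a ∷ W ∷ ∅ ∷ [])

    Improvable : Val n (Tuples k) → VSet n → Fin n → Set
    Improvable W B r = ∃[ v ] (v ∊ cellᵛ B r × Solved (cellᵛ B r − v) W)

    private opaque
      unfolding component

      improve-entry : ∀ {j} W B (S : Vec (Fin n) j) r → entry (⟦ improve k j ⟧ (a ∷ W ∷ B ∷ [])) S r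
        ≡ some (λ v → if cellᵛ (blocked B S) r v then solvedᵛ k (cellᵛ (blocked B S) r − v) W else false)
      improve-entry W B []      r = refl
      improve-entry W B (s ∷ S) r = improve-entry W _ S r

    opaque
      unfolding component

      improvement-sound : ∀ W S r → r ∊ entry (improvement W) S → Improvable W (blocked ∅ S) r
      improvement-sound W S r p =
        let v , q = some-sound _ (trans (sym (improve-entry W ∅ S r)) p) ; c , s = if-and q
        in v , c , solved-sound k s

      improvement-complete : ∀ W S r → Improvable W (blocked ∅ S) r → r ∊ entry (improvement W) S
      improvement-complete W S r (v , c , s) =
        trans (improve-entry W ∅ S r) (some-complete _ v (and-if c (solved-complete k s)))

    winningᵛ : Val n (Tuples k)
    winningᵛ = ⟦ winning k ⟧ (a ∷ [])

    private
      _⊑_ : Val n (Tuples k) → Val n (Tuples k) → Set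
      W ⊑ W′ = ∀ S r → r ∊ entry W S → r ∊ entry W′ S

      Solved-mono : ∀ {X W W′} → W ⊑ W′ → Solved X W → Solved X W′
      Solved-mono le h r x = let S , w , e = h r x in S , le S r w , e

      improvement-mono : ∀ W W′ → W ⊑ W′ → improvement W ⊑ improvement W′
      improvement-mono W W′ le S r p = let v , c , s = improvement-sound W S r p in
        improvement-complete W′ S r (v , c , Solved-mono le s)

      none-entry : ∀ {Γ} {ρ : Env n Γ} k S r → ¬ (r ∊ entry {k} (⟦ none k ⟧ ρ) S)
      none-entry zero    []      r ()
      none-entry (suc k) (s ∷ S) r = none-entry k S r

    -- The improvement is monotone and the first table is empty, so each iterate is contained in its
    -- own improvement. A mark in the last table is thus justified by that table itself, stationary
    -- or not.
    winning-sound : ∀ S r → r ∊ entry winningᵛ S → Improvable winningᵛ (blocked ∅ S) r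
    winning-sound S r p = improvement-sound winningᵛ S r
      (foldFin-invariant {m = n} {f = λ _ → improvement} (λ W → W ⊑ improvement W)
        (λ i W le → improvement-mono W _ le) (⟦ none k ⟧ (a ∷ []))
        (λ S r p → ⊥-elim (none-entry k S r p)) S r p)

    winning-complete : (P : ℕ → Val n (Tuples k) → Set) → (∀ W → P 0 W) →
      (∀ i W → P i W → P (suc i) (improvement W)) → P n winningᵛ
    winning-complete P p₀ ps =
      foldFin-count {m = n} {f = λ _ → improvement} P (λ _ → ps) _ (p₀ (⟦ none k ⟧ (a ∷ [])))

-- Elimination orderings from tree decompositions

argmax : ∀ {n} (X : VSet n) (f : Fin n → ℕ) {x} → x ∊ X → ∃[ y ] (y ∊ X × ∀ z → z ∊ X → f z ≤ f y)
argmax {suc n} X f {x} x∈X with any? (λ i → X (suc i) Bool.≟ true)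
... | no none = x , x∈X , λ z z∈X → ≤-reflexive (cong f (trans (is-zero z z∈X) (sym (is-zero x x∈X))))
  where
  is-zero : ∀ z → z ∊ X → z ≡ zero
  is-zero zero    _ = refl
  is-zero (suc z) p = ⊥-elim (none (z , p))
... | yes (_ , p) with argmax (X ∘ suc) (f ∘ suc) p | X zero Bool.≟ true
...   | y , y∈X , h | no 0∉X = suc y , y∈X , λ { zero p → ⊥-elim (0∉X p) ; (suc z) → h z }
...   | y , y∈X , h | yes 0∈X with f zero ≤? f (suc y)
...     | yes le = suc y , y∈X , λ { zero _ → le ; (suc z) → h z }
...     | no gt  = zero , 0∈X , λ { zero _ → ≤-refl ; (suc z) p → ≤-trans (h z p) (≰⇒≥ gt) }

adj-irrefl : ∀ {n} (G : Graph n) {u v} → Adj G u v → u ≢ v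
adj-irrefl G {u} p refl with () ← trans (sym p) (loopless G u)

module Forest {m} (F : Graph m) (acyclic : ¬ Cycle F) where

  private
    F-sym : ∀ {u v} → Adj F u v → Adj F v u
    F-sym {u} {v} p = trans (symmetric F v u) p

  record Path (A : Subset m) (len : ℕ) : Set where
    field
      at        : Fin (suc len) → Fin m
      injective : Injective _≡_ _≡_ at
      inside    : ∀ i → at i ∈ A
      step      : ∀ i → Adj F (at (inject₁ i)) (at (suc i))

  open Path

  -- The first `3 + e` vertices of the path, closed by the chord.
  chord⇒cycle : ∀ {A len} (P : Path A len) e i → toℕ i ≡ 2 + e → Adj F (at P zero) (at P i) → Cycle F
  chord⇒cycle {len = len} P e i i≡ chord = record
    { vertex    = λ j → at P (inject≤ j le)
    ; injective = λ eq → inject≤-injective le le _ _ (injective P eq)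
    ; step      = λ j → subst (λ x → Adj F (at P x) (at P (inject≤ (suc j) le)))
        (toℕ-injective (trans (toℕ-inject₁ _) (trans (toℕ-inject≤ j (s≤s⁻¹ le))
          (sym (trans (toℕ-inject≤ (inject₁ j) le) (toℕ-inject₁ j))))))
        (subst (λ x → Adj F (at P (inject₁ (inject≤ j (s≤s⁻¹ le)))) (at P x))
          (toℕ-injective (trans (cong suc (toℕ-inject≤ j (s≤s⁻¹ le))) (sym (toℕ-inject≤ (suc j) le))))
          (step P (inject≤ j (s≤s⁻¹ le))))
    ; close     = subst (λ x → Adj F (at P x) (at P zero))
        (toℕ-injective (trans i≡ (sym (trans (toℕ-inject≤ (fromℕ (2 + e)) le) (toℕ-fromℕ (2 + e))))))
        (F-sym chord)
    }
    where
    le : 3 + e ≤ suc len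
    le = subst (λ x → suc x ≤ suc len) i≡ (toℕ<n i)

  module _ (A : Subset m) where

    Leaf : Fin m → Set
    Leaf x = x ∈ A × (∀ y z → y ∈ A → z ∈ A → Adj F x y → Adj F x z → y ≡ z)

    -- The first vertex of a path that cannot be extended has no neighbour but the second one.
    leaf-of-path : ∀ f {len} → m ≤ f + len → Path A len → ∃[ x ] Leaf x
    -- The `suc len` vertices of the path are distinct, so `len` stays below `m` and the fuel cannot
    -- run out.
    leaf-of-path zero    m≤ P = ⊥-elim (<-irrefl refl (≤-trans (injective⇒≤ (injective P)) m≤))
    leaf-of-path (suc f) {len} m≤ P with any? (λ y → y ∈? A ×-dec (adj F (at P zero) y Bool.≟ true) ×-dec all? (λ i → ¬? (y ≟ at P i)))
    ... | yes (y , y∈A , e , new) = leaf-of-path f (≤-trans m≤ (≤-reflexive (sym (+-suc f len)))) record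
      { at        = λ { zero → y ; (suc i) → at P i }
      ; injective = λ { {zero} {zero} _ → refl
                      ; {zero} {suc j} eq → ⊥-elim (new j eq)
                      ; {suc i} {zero} eq → ⊥-elim (new i (sym eq))
                      ; {suc i} {suc j} eq → cong suc (injective P eq) }
      ; inside    = λ { zero → y∈A ; (suc i) → inside P i }
      ; step      = λ { zero → F-sym e ; (suc i) → step P i }
      }
    ... | no maximal = at P zero , inside P zero , λ y z y∈A z∈A e e′ →
          let i , i≡1 , y≡ = second y y∈A e ; j , j≡1 , z≡ = second z z∈A e′
          in trans y≡ (trans (cong (at P) (toℕ-injective (trans i≡1 (sym j≡1)))) (sym z≡))
      where
      second : ∀ y → y ∈ A → Adj F (at P zero) y → ∃[ i ] (toℕ i ≡ 1 × y ≡ at P i)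
      second y y∈A e with any? (λ i → y ≟ at P i)
      ... | no ∄i = ⊥-elim (maximal (y , y∈A , e , λ i y≡ → ∄i (i , y≡)))
      ... | yes (i , y≡) with toℕ i in i≡
      ...   | 0 = ⊥-elim (adj-irrefl F e (trans (cong (at P) (toℕ-injective (sym i≡))) (sym y≡)))
      ...   | 1 = i , i≡ , y≡
      ...   | suc (suc c) = ⊥-elim (acyclic (chord⇒cycle P c i i≡ (subst (Adj F (at P zero)) y≡ e)))

    leaf : Nonempty A → ∃[ x ] Leaf x
    leaf (x , x∈A) = leaf-of-path m (≤-reflexive (sym (+-identityʳ m))) record
      { at = λ _ → x ; injective = λ { {zero} {zero} _ → refl } ; inside = λ _ → x∈A ; step = λ () }

  -- Removing leaves one after the other orders a forest such that each node has at most one later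
  -- neighbour, its parent.
  record Peeling (A : Subset m) : Set where
    field
      rank           : Fin m → ℕ
      rank-injective : ∀ {x y} → x ∈ A → y ∈ A → rank x ≡ rank y → x ≡ y
      parent-unique  : ∀ {x y z} → x ∈ A → y ∈ A → z ∈ A → Adj F x y → Adj F x z →
                       rank x < rank y → rank x < rank z → y ≡ z

  open Peeling

  peel : ∀ s A → ∣ A ∣ ≤ s → Peeling A
  peel s A ∣A∣≤s with nonempty? A
  ... | no empty = record
    { rank           = λ _ → 0
    ; rank-injective = λ x∈A → ⊥-elim (empty (_ , x∈A))
    ; parent-unique  = λ x∈A → ⊥-elim (empty (_ , x∈A)) }
  peel zero A ∣A∣≤0 | yes (x , x∈A) = ⊥-elim (n≮0 (≤-trans (x∈p⇒∣p-x∣<∣p∣ x∈A) ∣A∣≤0))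
  peel (suc s) A ∣A∣≤s | yes ne with leaf A ne
  ... | l , l∈A , unique = record
    { rank           = rk
    ; rank-injective = inj
    ; parent-unique  = par }
    where
    P : Peeling (A ∖ l)
    P = peel s (A ∖ l) (s≤s⁻¹ (≤-trans (x∈p⇒∣p-x∣<∣p∣ l∈A) ∣A∣≤s))

    rk : Fin m → ℕ
    rk x with x ≟ l
    ... | yes _ = 0
    ... | no _  = suc (rank P x)

    inj : ∀ {x y} → x ∈ A → y ∈ A → rk x ≡ rk y → x ≡ y
    inj {x} {y} x∈A y∈A eq with x ≟ l | y ≟ l
    ... | yes refl | yes refl = refl
    ... | no x≢l | no y≢l =
      rank-injective P (x∈p∧x≢y⇒x∈p-y x∈A x≢l) (x∈p∧x≢y⇒x∈p-y y∈A y≢l) (ℕ.suc-injective eq)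

    par : ∀ {x y z} → x ∈ A → y ∈ A → z ∈ A → Adj F x y → Adj F x z → rk x < rk y → rk x < rk z → y ≡ z
    par {x} {y} {z} x∈A y∈A z∈A e e′ lt lt′ with x ≟ l | y ≟ l | z ≟ l
    ... | yes refl | _      | _      = unique y z y∈A z∈A e e′
    ... | no x≢l   | no y≢l | no z≢l = parent-unique P
      (x∈p∧x≢y⇒x∈p-y x∈A x≢l) (x∈p∧x≢y⇒x∈p-y y∈A y≢l) (x∈p∧x≢y⇒x∈p-y z∈A z≢l) e e′ (s≤s⁻¹ lt) (s≤s⁻¹ lt′)

  peeling : Peeling ⊤
  peeling = peel m ⊤ (∣p∣≤n ⊤)

  node-rank : Fin m → ℕ
  node-rank = rank peeling

  data Climb (X : VSet m) : Fin m → Fin m → Set where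
    stop : ∀ {x} → Climb X x x
    up   : ∀ {x y z} → Adj F x y → node-rank x < node-rank y → y ∊ X → Climb X y z → Climb X x z

  -- A walk to the highest node can be made ascending: after a step down from `x`, the rest of the
  -- walk ascends by induction, and it begins by going back to `x`, the only parent.
  climb : ∀ {X : VSet m} {x t} → (∀ y → y ∊ X → node-rank y ≤ node-rank t) →
    Star (λ u v → Adj F u v × u ∊ X × v ∊ X) x t → Climb X x t
  climb max ε = stop
  climb {x = x} max (_◅_ {j = y} (e , x∈X , y∈X) r) with climb max r | <-cmp (node-rank x) (node-rank y)
  ... | c | tri< lt _ _ = up e lt y∈X c
  ... | c | tri≈ _ eq _ = ⊥-elim (adj-irrefl F e (rank-injective peeling ∈⊤ ∈⊤ eq))
  ... | stop | tri> _ _ gt = ⊥-elim (<⇒≱ gt (max x x∈X))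
  ... | up e′ lt _ c | tri> _ _ gt with parent-unique peeling ∈⊤ ∈⊤ ∈⊤ e′ (F-sym e) lt gt
  ...   | refl = c

  -- Climbs from the same node follow the same parents, so the lower of the two ends lies on the
  -- other climb.
  climb-∊ : ∀ {X Y : VSet m} {s t u} → Climb X s t → Climb Y s u → node-rank t ≤ node-rank u → s ∊ Y → t ∊ Y
  climb-∊ stop d le s∈Y = s∈Y
  climb-∊ (up e lt _ c) stop le s∈Y = ⊥-elim (<⇒≱ (<-≤-trans lt (climb-≤ c)) le)
    where
    climb-≤ : ∀ {X x t} → Climb X x t → node-rank x ≤ node-rank t
    climb-≤ stop = ≤-refl
    climb-≤ (up _ lt _ c) = ≤-trans (<⇒≤ lt) (climb-≤ c)
  climb-∊ (up e lt _ c) (up e′ lt′ y∈Y d) le s∈Y with parent-unique peeling ∈⊤ ∈⊤ ∈⊤ e e′ lt lt′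
  ... | refl = climb-∊ c d le y∈Y

-- A perfect elimination ordering of the graph in which vertices sharing a bag are adjacent.
record Elimination {n} (G : Graph n) (k : ℕ) : Set₁ where
  field
    Linked        : Fin n → Fin n → Set
    linked-sym    : ∀ {u v} → Linked u v → Linked v u
    adj⇒linked    : ∀ {u v} → Adj G u v → Linked u v
    position      : Fin n → ℕ
    injective     : ∀ {u v} → position u ≡ position v → u ≡ v
    clique        : Fin n → Subset n
    clique-size   : ∀ v → ∣ clique v ∣ ≤ suc k
    centre        : ∀ v → v ∈ clique v
    clique-linked : ∀ v {u w} → u ∈ clique v → w ∈ clique v → Linked u w
    later         : ∀ {u v} → Linked u v → position v < position u → u ∈ clique v

-- Vertices are ordered by the highest node whose bag contains them. If `u` and `v` share a bag and
-- `v` comes first, both climb from this bag, and the climb of `u` passes through the top node of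
-- `v`. So `u` lies in the bag of that node, which is the clique of `v`.
elimination : ∀ {k n} {G : Graph n} → TreewidthAtMost k G → Elimination G k
elimination {k} {n} {G} (D , width) = record
  { Linked        = λ u v → ∃[ t ] (u ∈ bag D t × v ∈ bag D t)
  ; linked-sym    = λ (t , p , q) → t , q , p
  ; adj⇒linked    = edgeCovered D _ _
  ; position      = pos
  ; injective     = λ {u} {v} → pos-injective u v
  ; clique        = bag D ∘ top-node
  ; clique-size   = width ∘ top-node
  ; centre        = λ v → lookup⇒[]= v _ (proj₁ (proj₂ (highest v)))
  ; clique-linked = λ v p q → top-node v , p , q
  ; later         = λ {u} {v} (t , p , q) lt → lookup⇒[]= u _ (climb-∊
      (climb-to v t ([]=⇒lookup q)) (climb-to u t ([]=⇒lookup p)) (pos-top u v lt) ([]=⇒lookup p))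
  }
  where
  open Forest (tree D) (proj₂ (isTree D))

  nodes : Fin n → VSet (size D)
  nodes v t = lookup (bag D t) v

  highest : ∀ v → ∃[ t ] (t ∊ nodes v × ∀ s → s ∊ nodes v → node-rank s ≤ node-rank t)
  highest v = let (t , t∈) , _ = nodesConnected D v in
    argmax (nodes v) node-rank {t} (trans (sym (lookup∘tabulate _ t)) ([]=⇒lookup t∈))

  top-node : Fin n → Fin (size D)
  top-node v = proj₁ (highest v)

  climb-to : ∀ v s → s ∊ nodes v → Climb (nodes v) s (top-node v)
  climb-to v s s∈ = let t , t∈ , max = highest v in
    climb max (gmap id tree-edge (proj₂ (nodesConnected D v) s t (into s s∈) (into t t∈)))
    where
    into : ∀ t → t ∊ nodes v → t ∈ nodesOf D v
    into t p = lookup⇒[]= t _ (trans (lookup∘tabulate _ t) p)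

    tree-edge : ∀ {s t} → Edge (induced (tree D) (nodesOf D v)) s t → Adj (tree D) s t × s ∊ nodes v × t ∊ nodes v
    tree-edge {s} {t} e with adj (tree D) s t | lookup (nodesOf D v) s in p | lookup (nodesOf D v) t in q
    ... | true | true | true = refl , trans (sym (lookup∘tabulate _ s)) p , trans (sym (lookup∘tabulate _ t)) q

  -- The rank decides and ties are broken by the number of the vertex, which is recovered as the
  -- residue modulo `n`.
  pos : Fin n → ℕ
  pos v = toℕ v + node-rank (top-node v) * n

  pos-injective : ∀ u v → pos u ≡ pos v → u ≡ v
  pos-injective u v eq = toℕ-injective (trans (sym (residue u)) (trans (cong (_% n) eq) (residue v)))
    where
    instance
      n≢0 : NonZero n
      n≢0 = >-nonZero (≤-trans (s≤s z≤n) (toℕ<n u))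

    residue : ∀ v → pos v % n ≡ toℕ v
    residue v = trans ([m+kn]%n≡m%n (toℕ v) (node-rank (top-node v)) n) (m<n⇒m%n≡m (toℕ<n v))

  pos-top : ∀ u v → pos v < pos u → node-rank (top-node v) ≤ node-rank (top-node u)
  pos-top u v lt = ≮⇒≥ λ gt → <⇒≱ lt (begin
    toℕ u + node-rank (top-node u) * n  ≤⟨ +-monoˡ-≤ _ (<⇒≤ (toℕ<n u)) ⟩
    n + node-rank (top-node u) * n      ≤⟨ *-monoˡ-≤ n gt ⟩
    node-rank (top-node v) * n          ≤⟨ m≤n+m _ (toℕ v) ⟩
    pos v                               ∎)
    where open ≤-Reasoning

-- Completeness of the table of winning cells

size-of : ∀ {n} → VSet n → ℕ
size-of X = ∣ tabulate X ∣

∈-tabulate : ∀ {n} {X : VSet n} {u} → u ∊ X → u ∈ tabulate X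
∈-tabulate {X = X} {u} p = lookup⇒[]= u _ (trans (lookup∘tabulate X u) p)

∈-tabulate⁻ : ∀ {n} {X : VSet n} {u} → u ∈ tabulate X → u ∊ X
∈-tabulate⁻ {X = X} {u} p = trans (sym (lookup∘tabulate X u)) ([]=⇒lookup p)

size-of-< : ∀ {n} (X Y : VSet n) {v} → (∀ u → u ∊ X → u ∊ Y) → v ∊ Y → v ∌ X → size-of X < size-of Y
size-of-< X Y h y x = p⊂q⇒∣p∣<∣q∣ {p = tabulate X} {q = tabulate Y} ((λ p → ∈-tabulate (h _ (∈-tabulate⁻ p))) , _ , ∈-tabulate y , x ∘ ∈-tabulate⁻)

size-of-pos : ∀ {n} (X : VSet n) {v} → v ∊ X → 0 < size-of X
size-of-pos X p = ≤-<-trans z≤n (x∈p⇒∣p-x∣<∣p∣ (∈-tabulate {X = X} p))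

-- The repetitions of r only serve to pad the enumeration to length k.
enumerate : ∀ {n} k (p : Subset n) (r : Fin n) → ∣ p ∣ ≤ k →
  Σ (Vec (Fin n) k) λ S → (∀ u → u ∈ p → u ∈ᵛ S) × (∀ u → u ∈ᵛ S → u ∈ p ⊎ u ≡ r)
enumerate zero    p r le = [] , (λ u u∈p → ⊥-elim (n≮0 (≤-trans (x∈p⇒∣p-x∣<∣p∣ u∈p) le))) , λ u ()
enumerate (suc k) p r le with nonempty? p
... | no empty =
  replicate (suc k) r , (λ u u∈p → ⊥-elim (empty (u , u∈p))) , λ u → inj₂ ∘ constant (suc k)
  where
  constant : ∀ k {u} → u ∈ᵛ replicate k r → u ≡ r
  constant (suc k) (here u≡r) = u≡r
  constant (suc k) (there p)  = constant k p
... | yes (x , x∈p) =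
  let S , into , back = enumerate k (p ∖ x) r (s≤s⁻¹ (≤-trans (x∈p⇒∣p-x∣<∣p∣ x∈p) le))
  in x ∷ S , forth S into , λ { u (here refl) → inj₁ x∈p ; u (there i) → [ inj₁ ∘ p─q⊆p p ⁅ x ⁆ , inj₂ ]′ (back u i) }
  where
  forth : ∀ S → (∀ u → u ∈ p ∖ x → u ∈ᵛ S) → ∀ u → u ∈ p → u ∈ᵛ x ∷ S
  forth S into u u∈p with u ≟ x
  ... | yes refl = here refl
  ... | no u≢x   = there (into u (x∈p∧x≢y⇒x∈p-y u∈p u≢x))

member? : ∀ {n} (X : VSet n) u → u ∊ X ⊎ u ∌ X
member? X u with X u
... | true  = inj₁ refl
... | false = inj₂ λ ()

module Completeness {n q : ℕ} (q≤n : q ≤ n) {k} (G : Graph n) (El : Elimination G k) where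

  open Algorithm q≤n G
  open Elimination El

  -- If a walk through `X` joins `s` to `v`, then the two are linked: the vertices of the walk are
  -- bypassed in the order of their positions until only `s` and the last vertex `v` are left.
  module Fill {X : VSet n} {s v} (v∈X : v ∊ X) (last : ∀ u → u ∊ X → position u ≤ position v)
                               (beyond : ∀ u → u ∊ X → position u < position s) where

    Live : ℕ → Fin n → Set
    Live i u = (u ∊ X ⊎ u ≡ s) × i ≤ position u

    Walk : ℕ → Fin n → Fin n → Set
    Walk i = Star (λ u w → Linked u w × Live i u × Live i w)

    -- The vertex at position i can be bypassed, since its later neighbours are linked to each other.
    bypass : ∀ {i a b} → Live (suc i) b → Walk i a b →
      (Live (suc i) a → Walk (suc i) a b) ×
      (∀ {c} → Live (suc i) c → Linked c a → position a ≡ i → Walk (suc i) c b)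
    bypass (_ , lt) ε = (λ _ → ε) , λ { _ _ refl → ⊥-elim (<-irrefl refl lt) }
    bypass {i} {a} {b} live-b (_◅_ {j = a′} (l , (m , le) , (m′ , le′)) w) with bypass live-b w | i ℕ.≟ position a′
    ... | keep , skip | yes i≡ =
      (λ live-a → skip live-a l (sym i≡)) ,
      λ {c} live-c l′ a≡ → skip live-c (subst (Linked c) (injective (trans a≡ i≡)) l′) (sym i≡)
    ... | keep , skip | no i≢ =
      (λ live-a → (l , live-a , live′) ◅ keep live′) ,
      λ { {c} live-c l′ refl →
        (clique-linked a (later l′ (proj₂ live-c)) (later (linked-sym l) (proj₂ live′)) , live-c , live′) ◅ keep live′ }
      where
      live′ : Live (suc i) a′
      live′ = m′ , ≤∧≢⇒< le′ i≢

    bypass-all : ∀ i → i ≤ position v → Walk 0 s v → Walk i s v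
    bypass-all zero    le w = w
    bypass-all (suc i) le w = proj₁ (bypass (inj₁ v∈X , le) (bypass-all i (≤-trans (n≤1+n i) le) w))
      (inj₂ refl , ≤-trans le (<⇒≤ (beyond v v∈X)))

    linked-last : Walk (position v) s v → Linked s v
    linked-last ε = ⊥-elim (<-irrefl refl (beyond v v∈X))
    linked-last ((l , _ , inj₂ refl , _) ◅ w) = linked-last w
    linked-last ((l , _ , inj₁ p , le) ◅ w)   = subst (Linked s) (injective (≤-antisym (last _ p) le)) l

    in-clique : Walk 0 s v → s ∈ clique v
    in-clique w = later (linked-last (bypass-all (position v) ≤-refl w)) (beyond v v∈X)

  -- This holds for the components left over when vertices are removed from the last position
  -- downwards, and it confines their boundaries to single cliques.
  Late : VSet n → Set
  Late X = ∀ {u s} → u ∊ X → s ∌ X → Adj G u s → ∀ x → x ∊ X → position x < position s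

  Late-cong : ∀ {X Y} → (∀ u → X u ≡ Y u) → Late X → Late Y
  Late-cong e late p q adj x y =
    late (trans (e _) p) (q ∘ trans (sym (e _))) adj x (trans (e x) y)

  module _ {X r} (r∈X : r ∊ X) (late : Late (component X r)) where

    private
      K : VSet n
      K = component X r

      r∈K : r ∊ K
      r∈K = component-refl r∈X

      -- The boundary lies in the clique of the last vertex `v` of `K`. That clique also contains
      -- `v` itself, which is not in the boundary; this improves `suc k` to `k`.
      boundary-size : ∣ tabulate (boundary K) ∣ ≤ k
      boundary-size = let v , v∈K , last = argmax K position r∈K in
        s≤s⁻¹ (≤-trans (p⊂q⇒∣p∣<∣q∣ {q = clique v}
          ((λ {s} p → in-clique-of v v∈K last s (∈-tabulate⁻ p)) , v , centre v ,
           λ p → proj₁ (boundary-elim (∈-tabulate⁻ p)) v∈K)) (clique-size v))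
        where
        in-clique-of : ∀ v → v ∊ K → (∀ u → u ∊ K → position u ≤ position v) → ∀ s → s ∊ boundary K → s ∈ clique v
        in-clique-of v v∈K last s b =
          let s∉K , u , u∈K , e = boundary-elim b
              open Fill {X = K} {s} {v} v∈K last (late u∈K s∉K e)
              walk : ∀ {w} → w ∊ component X u → Walk 0 s w
              walk p = proj₁ (component-ind (λ w → Walk 0 s w × w ∊ K)
                (λ (w , w∈K) x y e′ → let w′∈K = component-step w∈K y e′ in
                  w ◅◅ ((adj⇒linked e′ , (inj₁ w∈K , z≤n) , (inj₁ w′∈K , z≤n)) ◅ ε) , w′∈K)
                ((linked-sym (adj⇒linked e) , (inj₂ refl , z≤n) , (inj₁ u∈K , z≤n)) ◅ ε , u∈K) p)
          in in-clique (walk (component-trans (component-sym u∈K) v∈K))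

    separator : ∃[ S ] (∀ u → K u ≡ cellᵛ (blocked {k} ∅ S) r u)
    separator = let S , into , back = enumerate k (tabulate (boundary K)) r boundary-size in
      S , same-set
        (component-⊆ (λ p q y e → inside S back (component-step p y e)) (or-ifˡ (≟-complete {i = r} refl)))
        (component-⊆ (λ p q y e → [ proj₂ ∘ component⊆ , (λ w∉K →
            [ (λ w≡r → subst (_∊ X) (sym (≟-sound w≡r)) r∈X)
            , (λ free → ⊥-elim (if-not free (blocked-entry (into _ (∈-tabulate (boundary-intro q w∉K e))))))
            ]′ (if-or y)) ]′ (member? K _)) r∈X)
      where
      inside : ∀ S → (∀ u → u ∈ᵛ S → u ∈ tabulate (boundary K) ⊎ u ≡ r) → ∀ {w} → w ∊ K → w ∊ outside (blocked ∅ S) r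
      inside S back {w} w∈K with w ≟ r
      ... | yes w≡r = refl
      ... | no w≢r  = not-if λ b → [ (λ ()) , (λ w∈S →
        [ (λ p → proj₁ (boundary-elim (∈-tabulate⁻ p)) w∈K) , w≢r ]′ (back w w∈S)) ]′ (blocked-elim S b)

  Won : ℕ → Val n (Tuples k) → Set
  Won i W = ∀ S r → Late (cellᵛ (blocked ∅ S) r) → size-of (cellᵛ (blocked ∅ S) r) ≤ i → r ∊ entry W S

  r∈cell : ∀ {B r} → r ∊ cellᵛ B r
  r∈cell {r = r} = component-refl (or-ifˡ (≟-complete {i = r} refl))

  solved-if : ∀ i W X → Won i W → (∀ r → r ∊ X → Late (component X r)) →
    (∀ r → size-of (component X r) ≤ i) → Solved X W
  solved-if i W X won late small r r∈X =
    let S , e = separator r∈X (late r r∈X)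
    in S , won S r (Late-cong e (late r r∈X)) (subst (_≤ i) (cong ∣_∣ (tabulate-cong e)) (small r)) , e

  -- The winning choice is the last vertex of the cell. The components of the rest are smaller, and
  -- they are late again: a neighbour outside such a component is outside the cell or is the removed
  -- vertex.
  Won-improves : ∀ i W → Won i W → Won (suc i) (improvement k W)
  Won-improves i W won S r late small =
    let K = cellᵛ (blocked ∅ S) r
        v , v∈K , last = argmax K position (r∈cell {blocked ∅ S} {r})
    in improvement-complete k W S r (v , v∈K , solved-if i W (K − v) won
      (λ r′ r′∈ {u} {s} p s∉ e x x∈ → later-than v last s s∉ e p x x∈)
      (λ r′ → s≤s⁻¹ (≤-trans (size-of-< (component (K − v) r′) K (λ u p → proj₁ (−-elim K v (proj₂ (component⊆ p)))) v∈K
        (λ p → proj₂ (−-elim K v (proj₂ (component⊆ p))) refl)) small)))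
    where
    later-than : let K = cellᵛ (blocked ∅ S) r in ∀ v → (∀ z → z ∊ K → position z ≤ position v) →
      ∀ {r′ u} s → s ∌ component (K − v) r′ → Adj G u s → u ∊ component (K − v) r′ →
      ∀ x → x ∊ component (K − v) r′ → position x < position s
    later-than v last {r′} s s∉ e p x x∈ with member? (cellᵛ (blocked ∅ S) r) s | s ≟ v
    ... | inj₁ s∈K | no s≢v = ⊥-elim (s∉ (component-step p (−-intro (cellᵛ (blocked ∅ S) r) v s∈K s≢v) e))
    ... | inj₂ s∉K | _ = late (proj₁ (−-elim (cellᵛ (blocked ∅ S) r) v (proj₂ (component⊆ p)))) s∉K e x (proj₁ (−-elim (cellᵛ (blocked ∅ S) r) v (proj₂ (component⊆ x∈))))
    ... | _ | yes refl = let x∈K , x≢v = −-elim (cellᵛ (blocked ∅ S) r) v (proj₂ (component⊆ x∈)) in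
      ≤∧≢⇒< (last x x∈K) (x≢v ∘ injective)

  solved-full : Solved (λ _ → true) (winningᵛ k)
  solved-full = solved-if n (winningᵛ k) (λ _ → true)
    (winning-complete k Won (λ W S r _ small → ⊥-elim (n≮0 (<-≤-trans (size-of-pos (cellᵛ (blocked ∅ S) r) (r∈cell {blocked ∅ S})) small))) Won-improves)
    -- A component of the whole graph has no outside neighbours, so it is late vacuously.
    (λ r _ p s∉ e → ⊥-elim (s∉ (component-step p refl e)))
    (λ r → ∣p∣≤n (tabulate (component (λ _ → true) r)))

-- Counting ancestors

unique-length : ∀ {A : Set} {m} (g : Fin m → A) {xs} → Unique xs → (∀ x → x ∈ˡ xs → ∃[ i ] g i ≡ x) → length xs ≤ m
unique-length g {xs} unique preimage = injective⇒≤ {f = λ i → proj₁ (pre i)} λ {i} {j} eq →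
  lookup-injective unique i j (trans (sym (proj₂ (pre i))) (trans (cong g eq) (proj₂ (pre j))))
  where
  pre : ∀ i → ∃[ j ] g j ≡ List.lookup xs i
  pre i = preimage _ (∈-lookup i)

  lookup-injective : ∀ {xs} → Unique xs → ∀ i j → List.lookup xs i ≡ List.lookup xs j → i ≡ j
  lookup-injective (p ∷ ps) zero    zero    eq = refl
  lookup-injective (p ∷ ps) zero    (suc j) eq = ⊥-elim (All.lookup p (∈-lookup j) eq)
  lookup-injective (p ∷ ps) (suc i) zero    eq = ⊥-elim (All.lookup p (∈-lookup i) (sym eq))
  lookup-injective (p ∷ ps) (suc i) (suc j) eq = cong suc (lookup-injective ps i j eq)

C-positive : ∀ m w → 1 ≤ (m + w) C w
C-positive m zero    = ≤-refl
C-positive m (suc w) = begin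
  1                                   ≤⟨ C-positive m w ⟩
  (m + w) C w                         ≤⟨ m≤m+n _ _ ⟩
  (m + w) C w + (m + w) C suc w       ≡⟨ nCk+nC[k+1]≡[n+1]C[k+1] (m + w) w ⟩
  suc (m + w) C suc w                 ≡⟨ cong (_C suc w) (+-suc m w) ⟨
  (m + suc w) C suc w                 ∎
  where open ≤-Reasoning

pascal : ∀ q w → (q + suc w) C suc w + (suc q + w) C w ≡ (suc q + suc w) C suc w
pascal q w = begin
  (q + suc w) C suc w + (suc q + w) C w   ≡⟨ cong (λ m → m C suc w + (suc q + w) C w) (+-suc q w) ⟩
  (suc q + w) C suc w + (suc q + w) C w   ≡⟨ +-comm ((suc q + w) C suc w) _ ⟩
  (suc q + w) C w + (suc q + w) C suc w   ≡⟨ nCk+nC[k+1]≡[n+1]C[k+1] (suc q + w) w ⟩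
  suc (suc q + w) C suc w                 ≡⟨ cong (λ m → suc m C suc w) (+-suc q w) ⟨
  (suc q + suc w) C suc w                 ∎
  where open ≡-Reasoning

module History {n q : ℕ} (q≤n : q ≤ n) (k : ℕ) (G : Graph n) (cells : Fin n → VSet n) where

  open Algorithm q≤n G

  _⇡_ : Fin n → Fin n → Set
  x ⇡ y = y ∊ boundary (cells x)

  -- The tuple `separator` serves only to bound the number of parents by `k`.
  record Placed (w : Fin n) (older : List (Fin n)) : Set where
    field
      own       : w ∊ cells w
      excludes  : ∀ {u} → u ∈ˡ older → u ∌ cells w
      above     : ∀ {u} → w ⇡ u → u ∈ˡ older
      nested    : ∀ {u} → w ⇡ u → ∀ x → x ∊ cells w → x ∊ cells u
      separator : Vec (Fin n) k
      separates : ∀ {u} → w ⇡ u → u ∈ᵛ separator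

  open Placed

  -- The vertex eliminated last comes first.
  data History : List (Fin n) → Set where
    []  : History []
    _∷_ : ∀ {w h} → Placed w h → History h → History (w ∷ h)

  placed : ∀ {h} → History h → ∀ {x} → x ∈ˡ h →
    ∃[ older ] (Placed x older × (∀ {u} → u ∈ˡ older → u ∈ˡ h) × History older)
  placed (p ∷ H) (here refl) = _ , p , there , H
  placed (p ∷ H) (there x∈)  = let _ , p′ , le , H′ = placed H x∈ in _ , p′ , there ∘ le , H′

  above∈ : ∀ {h} → History h → ∀ {x y} → x ∈ˡ h → x ⇡ y → y ∈ˡ h
  above∈ H x∈ e = let _ , p , le , _ = placed H x∈ in le (above p e)

  -- Let `y` be the newer of the two. The cell of `x` has a neighbour of `z` and is contained in the
  -- cell of `y`, which does not contain the older vertex `z`. So `z` is on the boundary of the cell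
  -- of `y`.
  comparable : ∀ {h} → History h → ∀ {x y z} → x ∈ˡ h → y ∈ˡ h → z ∈ˡ h → x ⇡ y → x ⇡ z → y ≢ z → y ⇡ z ⊎ z ⇡ y
  comparable {h} H {x} {y} {z} x∈ y∈ z∈ x⇡y x⇡z = order-of H y∈ z∈
    where
    P : Placed x _
    P = proj₁ (proj₂ (placed H x∈))

    ascend : ∀ {y z} → x ⇡ y → x ⇡ z → z ∌ cells y → y ⇡ z
    ascend x⇡y x⇡z z∉ = let _ , u , u∈ , e = boundary-elim x⇡z in boundary-intro (nested P x⇡y u u∈) z∉ e

    order-of : ∀ {h} → History h → y ∈ˡ h → z ∈ˡ h → y ≢ z → y ⇡ z ⊎ z ⇡ y
    order-of (p ∷ H) (here refl) (here refl) y≢z = ⊥-elim (y≢z refl)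
    order-of (p ∷ H) (here refl) (there z∈)  y≢z = inj₁ (ascend x⇡y x⇡z (excludes p z∈))
    order-of (p ∷ H) (there y∈)  (here refl) y≢z = inj₂ (ascend x⇡z x⇡y (excludes p y∈))
    order-of (p ∷ H) (there y∈)  (there z∈)  y≢z = order-of H y∈ z∈ y≢z

  Ancestor : ℕ → Fin n → Fin n → Set
  Ancestor zero    x u = x ≡ u
  Ancestor (suc i) x u = x ≡ u ⊎ ∃[ y ] (x ⇡ y × Ancestor i y u)

  Ancestor-refl : ∀ i {x} → Ancestor i x x
  Ancestor-refl zero    = refl
  Ancestor-refl (suc i) = inj₁ refl

  Ancestor-suc : ∀ i {x u} → Ancestor i x u → Ancestor (suc i) x u
  Ancestor-suc zero    p = inj₁ p
  Ancestor-suc (suc i) (inj₁ p) = inj₁ p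
  Ancestor-suc (suc i) (inj₂ (y , e , p)) = inj₂ (y , e , Ancestor-suc i p)

  Beyond : ℕ → List (Fin n) → Fin n → Set
  Beyond i zs u = ∃[ z ] (z ∈ˡ zs × Ancestor i z u)

  module _ {h} (H : History h) where

    full : ∀ {x zs} → x ∈ˡ h → Unique zs → (∀ z → z ∈ˡ zs → x ⇡ z) → length zs ≤ k
    full x∈ unique up = let _ , p , _ = placed H x∈ in
      unique-length (lookup (separator p)) unique
        (λ z z∈ → let s = separates p (up z z∈) in Anyᵛ.index s , sym (lookup-index s))

    -- At most `w` parents of `x` besides the given ones `zs` can contribute. The induction
    -- hypothesis is applied to each of these with the parents collected before it as the given
    -- ones, which are parents of it too.
    few-ancestors : ∀ i w x zs → x ∈ˡ h → Unique zs → (∀ z → z ∈ˡ zs → x ⇡ z) → k ≤ length zs + w →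
      ∃[ L ] (length L ≤ (i + w) C w × ∀ u → Ancestor i x u → u ∈ˡ L ⊎ Beyond i zs u)
    few-ancestors zero w x zs x∈ unique up big =
      x ∷ [] , ≤-reflexive (sym (nCn≡1 w)) , λ { u refl → inj₁ (here refl) }
    few-ancestors (suc i) w x zs x∈ unique up big = finish (scan H id)
      where
      Covered′ : List (Fin n) → Fin n → Set
      Covered′ L a = ∀ u → Ancestor i a u → u ∈ˡ L ⊎ Beyond (suc i) zs u

      -- The scan runs through the parents of x from the oldest one on.  The list zs′ extends zs by the
      -- parents found so far, except those reached from zs in one step.
      record Scan (hs : List (Fin n)) : Set where
        field
          L zs′    : List (Fin n)
          width    : ℕ
          unique′  : Unique zs′
          up′      : ∀ z → z ∈ˡ zs′ → x ⇡ z
          from     : ∀ z → z ∈ˡ zs′ → z ∈ˡ zs ⊎ z ∈ˡ hs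
          enough   : k ≤ length zs′ + width
          small    : length L + (suc i + width) C width ≤ (suc i + w) C w
          covers   : ∀ a → a ∈ˡ hs → x ⇡ a → Covered′ L a

      open Scan

      finish : Scan h → _
      finish s = x ∷ L s ,
        -- The part of the bound that is left over is positive and pays for `x` itself.
        ≤-trans (≤-reflexive (+-comm 1 (length (L s)))) (≤-trans (+-monoʳ-≤ (length (L s)) (C-positive (suc i) (width s))) (small s)) ,
        λ { u (inj₁ refl) → inj₁ (here refl)
          ; u (inj₂ (y , x⇡y , p)) → [ inj₁ ∘ there , inj₂ ]′ (covers s y (above∈ H x∈ x⇡y) x⇡y u p) }

      Blocking : Fin n → Fin n → Set
      Blocking a z = z ≡ a ⊎ z ⇡ a

      scan : ∀ {hs} → History hs → (∀ {u} → u ∈ˡ hs → u ∈ˡ h) → Scan hs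
      scan [] _ = record
        { L = [] ; zs′ = zs ; width = w ; unique′ = unique ; up′ = up ; from = λ z → inj₁ ; enough = big
        ; small = ≤-refl ; covers = λ a () }
      scan {a ∷ hs} (p ∷ H′) sub = extend (member? (boundary (cells x)) a)
        where
        s : Scan hs
        s = scan H′ (sub ∘ there)

        a∉hs : a ∉ˡ hs
        a∉hs a∈ = excludes p a∈ (own p)

        keep : (x ⇡ a → Covered′ (L s) a) → Scan (a ∷ hs)
        keep c = record
          { L = L s ; zs′ = zs′ s ; width = width s ; unique′ = unique′ s ; up′ = up′ s
          ; from = λ z z∈ → [ inj₁ , inj₂ ∘ there ]′ (from s z z∈) ; enough = enough s ; small = small s
          ; covers = λ { b (here refl) → c ; b (there b∈) → covers s b b∈ } }

        add : x ⇡ a → (∀ z → z ∈ˡ zs′ s → a ⇡ z) → a ∉ˡ zs′ s → Scan (a ∷ hs)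
        add x⇡a ups a∉ with width s in width≡
        -- With width 0 there would be more than `k` distinct parents of `x`.
        ... | zero = ⊥-elim (<-irrefl refl (≤-trans (full {zs = a ∷ zs′ s} x∈ (fresh ∷ unique′ s)
                (λ { z (here refl) → x⇡a ; z (there z∈) → up′ s z z∈ }))
                (≤-trans (enough s) (≤-reflexive (trans (cong (length (zs′ s) +_) width≡) (+-identityʳ _))))))
          where
          fresh : All (a ≢_) (zs′ s)
          fresh = All.tabulate λ z∈ a≡z → a∉ (subst (_∈ˡ zs′ s) (sym a≡z) z∈)
        ... | suc w′ =
          let M , M-small , M-covers = few-ancestors i (suc w′) a (zs′ s) (sub (here refl)) (unique′ s) ups
                (subst (λ w → k ≤ length (zs′ s) + w) width≡ (enough s))
          in record
          { L = M ++ L s ; zs′ = a ∷ zs′ s ; width = w′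
          ; unique′ = All.tabulate (λ z∈ a≡z → a∉ (subst (_∈ˡ zs′ s) (sym a≡z) z∈)) ∷ unique′ s
          ; up′ = λ { z (here refl) → x⇡a ; z (there z∈) → up′ s z z∈ }
          ; from = λ { z (here refl) → inj₂ (here refl) ; z (there z∈) → [ inj₁ , inj₂ ∘ there ]′ (from s z z∈) }
          ; enough = ≤-trans (subst (λ w → k ≤ length (zs′ s) + w) width≡ (enough s)) (≤-reflexive (+-suc _ w′))
          -- Pascal's rule splits the unspent part of the bound into the share of the new list `M`
          -- and the unspent part for the smaller width.
          ; small = begin
              length (M ++ L s) + (suc i + w′) C w′               ≡⟨ cong (_+ (suc i + w′) C w′) (length-++ M) ⟩
              length M + length (L s) + (suc i + w′) C w′         ≤⟨ +-monoˡ-≤ _ (+-monoˡ-≤ (length (L s)) M-small) ⟩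
              (i + suc w′) C suc w′ + length (L s) + (suc i + w′) C w′
                ≡⟨ cong (_+ (suc i + w′) C w′) (+-comm ((i + suc w′) C suc w′) _) ⟩
              length (L s) + (i + suc w′) C suc w′ + (suc i + w′) C w′
                ≡⟨ +-assoc (length (L s)) _ _ ⟩
              length (L s) + ((i + suc w′) C suc w′ + (suc i + w′) C w′)
                ≡⟨ cong (length (L s) +_) (pascal i w′) ⟩
              length (L s) + (suc i + suc w′) C suc w′
                ≤⟨ subst (λ w′ → length (L s) + (suc i + w′) C w′ ≤ (suc i + w) C w) width≡ (small s) ⟩
              (suc i + w) C w ∎
          ; covers = λ { b (here refl) _ u q → [ inj₁ ∘ ∈-++⁺ˡ , (λ (z , z∈ , r) → via M z u z∈ r) ]′ (M-covers u q)
                       ; b (there b∈) e u q → [ inj₁ ∘ ∈-++⁺ʳ M , inj₂ ]′ (covers s b b∈ e u q) }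
          }
          where
          open ≤-Reasoning
          via : ∀ M z u → z ∈ˡ zs′ s → Ancestor i z u → u ∈ˡ M ++ L s ⊎ Beyond (suc i) zs u
          via M z u z∈ r with from s z z∈
          ... | inj₁ z∈zs = inj₂ (z , z∈zs , Ancestor-suc i r)
          ... | inj₂ z∈hs = [ inj₁ ∘ ∈-++⁺ʳ M , inj₂ ]′ (covers s z z∈hs (up′ s z z∈) u r)

        -- Only one of the given `zs` can block `a`, since the parents found by the scan are older
        -- than `a` and their own parents are older still. The step from `z` to `a` is paid for by
        -- the radius `suc i` in `Covered′`.
        blocked-by : ∀ z → z ∈ˡ zs′ s → Blocking a z → Covered′ (L s) a
        blocked-by z z∈ b u r with from s z z∈ | b
        ... | inj₁ z∈zs | inj₁ refl = inj₂ (z , z∈zs , Ancestor-suc i r)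
        ... | inj₁ z∈zs | inj₂ z⇡a  = inj₂ (z , z∈zs , inj₂ (a , z⇡a , r))
        ... | inj₂ z∈hs | inj₁ refl = ⊥-elim (a∉hs z∈hs)
        ... | inj₂ z∈hs | inj₂ z⇡a  = ⊥-elim (a∉hs (above∈ H′ z∈hs z⇡a))

        search : ∀ l → (∀ z → z ∈ˡ l → z ∈ˡ zs′ s) → x ⇡ a →
          (∃[ z ] (z ∈ˡ zs′ s × Blocking a z)) ⊎ ((∀ z → z ∈ˡ l → a ⇡ z) × a ∉ˡ l)
        search []      inc x⇡a = inj₂ ((λ z ()) , λ ())
        search (z ∷ l) inc x⇡a with search l (λ y → inc y ∘ there) x⇡a | a ≟ z
        ... | inj₁ found | _ = inj₁ found
        ... | inj₂ _ | yes refl = inj₁ (z , inc z (here refl) , inj₁ refl)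
        ... | inj₂ (ups , a∉) | no a≢z
          with comparable H x∈ (sub (here refl)) (above∈ H x∈ (up′ s z (inc z (here refl)))) x⇡a (up′ s z (inc z (here refl))) a≢z
        ...   | inj₁ a⇡z = inj₂ ((λ { y (here refl) → a⇡z ; y (there y∈) → ups y y∈ }) ,
                                 λ { (here a≡z) → a≢z a≡z ; (there a∈) → a∉ a∈ })
        ...   | inj₂ z⇡a = inj₁ (z , inc z (here refl) , inj₂ z⇡a)

        extend : a ∊ boundary (cells x) ⊎ a ∌ boundary (cells x) → Scan (a ∷ hs)
        extend (inj₂ no-parent) = keep (⊥-elim ∘ no-parent)
        extend (inj₁ x⇡a) with search (zs′ s) (λ z → id) x⇡a
        ... | inj₁ (z , z∈ , b) = keep (λ _ → blocked-by z z∈ b)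
        ... | inj₂ (ups , a∉)   = add x⇡a ups a∉

-- The main loop

least : ∀ {n} (used : VSet n) m (g : Fin m → Fin n) (r₀ : Fin n) →
  let r = foldFin m (λ i r → if used (g i) then r else g i) r₀ in
  (∃[ i ] (r ≡ g i × g i ∌ used × ∀ j → toℕ j < toℕ i → g j ∊ used)) ⊎ (r ≡ r₀ × ∀ i → g i ∊ used)
least used zero    g r₀ = inj₂ (refl , λ ())
least used (suc m) g r₀ with least used m (g ∘ inject₁) (if used (g (fromℕ m)) then r₀ else g (fromℕ m))
... | inj₁ (i , eq , free , below) = inj₁ (inject₁ i , eq , free , below′)
  where
  below′ : ∀ j → toℕ j < toℕ (inject₁ i) → g j ∊ used
  below′ j lt with view j
  ... | ‵fromℕ     = ⊥-elim (<⇒≱ (subst (_< toℕ (inject₁ i)) (toℕ-fromℕ m) lt)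
                       (<⇒≤ (subst (_< m) (sym (toℕ-inject₁ i)) (toℕ<n i))))
  ... | ‵inject₁ j = below j (subst₂ _<_ (toℕ-inject₁ j) (toℕ-inject₁ i) lt)
... | inj₂ (eq , below) with used (g (fromℕ m)) in u
...   | false = inj₁ (fromℕ m , eq , (λ p → case trans (sym u) p of λ ()) , below′)
  where
  below′ : ∀ j → toℕ j < toℕ (fromℕ m) → g j ∊ used
  below′ j lt with view j
  ... | ‵fromℕ     = ⊥-elim (<-irrefl refl lt)
  ... | ‵inject₁ j = below j
...   | true  = inj₂ (eq , all-used)
  where
  all-used : ∀ j → g j ∊ used
  all-used j with view j
  ... | ‵fromℕ     = u
  ... | ‵inject₁ j = below j

-- The users of the `t` smallest colours are distinct, and together with `v` they are `suc t` values
-- of `g`.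
used-below : ∀ {n m t} (t≤n : t ≤ n) (col : Fin n → Fin n) (D : VSet n) {v} → v ∌ D → (g : Fin m → Fin n) →
  (∃[ i ] g i ≡ v) → (∀ u → u ∊ D → ∃[ i ] g i ≡ u) →
  (∀ c → toℕ c < t → ∃[ u ] (u ∊ D × col u ≡ c)) → t < m
used-below {t = t} t≤n col D {v} v∉D g (i₀ , g≡v) cover used = injective⇒≤ {f = f} f-injective
  where
  user : ∀ i → ∃[ u ] (u ∊ D × col u ≡ inject≤ i t≤n)
  user i = used (inject≤ i t≤n) (subst (_< t) (sym (toℕ-inject≤ i t≤n)) (toℕ<n i))

  place : ∀ i → ∃[ j ] g j ≡ proj₁ (user i)
  place i = cover _ (proj₁ (proj₂ (user i)))

  f : Fin (suc t) → Fin _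
  f zero    = i₀
  f (suc i) = proj₁ (place i)

  f-injective : ∀ {i j} → f i ≡ f j → i ≡ j
  f-injective {zero}  {zero}  eq = refl
  f-injective {zero}  {suc j} eq =
    ⊥-elim (v∉D (subst (_∊ D) (trans (sym (proj₂ (place j))) (trans (cong g (sym eq)) g≡v)) (proj₁ (proj₂ (user j)))))
  f-injective {suc i} {zero}  eq =
    ⊥-elim (v∉D (subst (_∊ D) (trans (sym (proj₂ (place i))) (trans (cong g eq) g≡v)) (proj₁ (proj₂ (user i)))))
  f-injective {suc i} {suc j} eq = cong suc (inject≤-injective t≤n t≤n i j
    (trans (sym (proj₂ (proj₂ (user i)))) (trans (cong col
      (trans (sym (proj₂ (place i))) (trans (cong g eq) (proj₂ (place j))))) (proj₂ (proj₂ (user j))))))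

module Main {n q : ℕ} (q≤n : q ≤ n) (k : ℕ) (G : Graph n) where

  open Algorithm q≤n G

  module Cells = History q≤n k G

  W : Val n (Tuples k)
  W = winningᵛ k

  outside-done : VSet n → VSet n
  outside-done done u = if done u then false else true

  putᵛ : ∀ τ → (Fin n → Val n τ) → Fin n → Val n τ → Fin n → Val n τ
  putᵛ τ f v x = ⟦ put {τ} ⟧ (f ∷ v ∷ x ∷ [])

  put-same : ∀ τ (f : Fin n → Val n τ) v x → putᵛ τ f v x v ≡ x
  put-same τ f v x rewrite ≟-complete {i = v} refl = refl

  put-other : ∀ τ (f : Fin n → Val n τ) v x {u} → u ≢ v → putᵛ τ f v x u ≡ f u
  put-other τ f v x {u} u≢v with u ≟ v
  ... | yes u≡v = ⊥-elim (u≢v u≡v)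
  ... | no _    = refl

  ancestorsᵛ : (Fin n → VSet n) → Fin n → VSet n
  ancestorsᵛ cells v = ⟦ ancestors ⟧ (adj G ∷ cells ∷ v ∷ [])

  module _ (cells : Fin n → VSet n) where

    open Cells cells

    -- `Ancestor` splits off the first step, whereas the program extends its set by a last step.
    Ancestor-snoc : ∀ i {x w u} → Ancestor i x w → w ⇡ u → Ancestor (suc i) x u
    Ancestor-snoc zero    refl             e = inj₂ (_ , e , refl)
    Ancestor-snoc (suc i) (inj₁ refl)      e = inj₂ (_ , e , inj₁ refl)
    Ancestor-snoc (suc i) (inj₂ (y , f , p)) e = inj₂ (y , f , Ancestor-snoc i p e)

    Ancestor-unsnoc : ∀ i {x u} → Ancestor (suc i) x u → Ancestor i x u ⊎ ∃[ w ] (Ancestor i x w × w ⇡ u)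
    Ancestor-unsnoc zero    (inj₁ p) = inj₁ p
    Ancestor-unsnoc zero    (inj₂ (y , e , refl)) = inj₂ (_ , refl , e)
    Ancestor-unsnoc (suc i) (inj₁ p) = inj₁ (inj₁ p)
    Ancestor-unsnoc (suc i) (inj₂ (y , e , p)) with Ancestor-unsnoc i p
    ... | inj₁ p′ = inj₁ (inj₂ (y , e , p′))
    ... | inj₂ (w , p′ , f) = inj₂ (w , inj₂ (y , e , p′) , f)

    ancestors-correct : ∀ v u → (u ∊ ancestorsᵛ cells v → Ancestor q v u) × (Ancestor q v u → u ∊ ancestorsᵛ cells v)
    ancestors-correct v = foldFin-count {m = q}
      (λ i D → ∀ u → (u ∊ D → Ancestor i v u) × (Ancestor i v u → u ∊ D))
      (λ _ i D h u →
        (λ p → [ (λ r → Ancestor-suc i (proj₁ (h u) r))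
               , (λ r → let w , s = some-sound _ r ; w∈ , e = if-and s in Ancestor-snoc i (proj₁ (h w) w∈) e) ]′ (if-or p)) ,
        (λ p → [ (λ r → or-ifˡ (proj₂ (h u) r))
               , (λ (w , r , e) → or-ifʳ {a = D u} (some-complete _ w (and-if (proj₂ (h w) r) e))) ]′ (Ancestor-unsnoc i p)))
      (λ u → does (u ≟ v))
      (λ u → (λ p → sym (≟-sound p)) , λ p → ≟-complete (sym p))

    Ancestor∈ : ∀ {h} → History h → ∀ i {x u} → x ∈ˡ h → Ancestor i x u → u ∈ˡ h
    Ancestor∈ H zero    x∈ refl = x∈
    Ancestor∈ H (suc i) x∈ (inj₁ refl) = x∈
    Ancestor∈ H (suc i) x∈ (inj₂ (y , e , p)) = Ancestor∈ H i (above∈ H x∈ e) p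

  module _ {cells cells′ : Fin n → VSet n} where

    open Cells

    -- An elimination changes the table of cells at the new vertex only, so the history of the older
    -- ones carries over.
    transport : ∀ {h} → (∀ {u} → u ∈ˡ h → cells u ≡ cells′ u) → History cells h → History cells′ h
    transport same [] = []
    transport {w ∷ h} same (p ∷ H) = record
      { own       = subst (w ∊_) (same (here refl)) (own p)
      ; excludes  = λ {u} u∈ → subst (u ∌_) (same (here refl)) (excludes p u∈)
      ; above     = λ e → above p (back e)
      ; nested    = λ e x x∈ → subst (x ∊_) (same (there (above p (back e))))
          (nested p (back e) x (subst (x ∊_) (sym (same (here refl))) x∈))
      ; separator = separator p
      ; separates = λ e → separates p (back e)
      } ∷ transport (same ∘ there) H
      where
      open Placed
      back : ∀ {u} → _⇡_ cells′ w u → _⇡_ cells w u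
      back {u} = subst (λ X → u ∊ boundary X) (sym (same (here refl)))

    Ancestor-transport : ∀ {h} → (∀ {u} → u ∈ˡ h → cells u ≡ cells′ u) → History cells h →
      ∀ i {x u} → x ∈ˡ h → Ancestor cells′ i x u → Ancestor cells i x u
    Ancestor-transport same H zero    x∈ p        = p
    Ancestor-transport same H (suc i) x∈ (inj₁ p) = inj₁ p
    Ancestor-transport same H (suc i) {x} x∈ (inj₂ (y , e , p)) =
      inj₂ (y , e′ , Ancestor-transport same H i (above∈ cells H x∈ e′) p)
      where e′ = subst (λ X → y ∊ boundary X) (sym (same x∈)) e

  colours : ℕ
  colours = (q + k) C k

  record Invariant (s : Val n state) : Set where
    done  = proj₁ s
    cells = proj₁ (proj₂ s)
    col   = proj₂ (proj₂ s)
    field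
      hist      : List (Fin n)
      history   : Cells.History cells hist
      done⇒hist : ∀ {u} → u ∊ done → u ∈ˡ hist
      hist⇒done : ∀ {u} → u ∈ˡ hist → u ∊ done
      -- From this `K⊆old` derives that the next cell is nested in the cells of its parents.
      attached  : ∀ {u x} → u ∊ done → x ∌ done → Adj G u x → x ∊ cells u
      remaining : Solved {k} (outside-done done) W
      proper    : ∀ {w u} → w ∈ˡ hist → Cells.Ancestor cells q w u → u ≢ w → col u ≢ col w
      few       : ∀ {w} → w ∈ˡ hist → toℕ (col w) < colours

  open Invariant

  eliminateᵛ : Val n state → Fin n → VSet n → Val n state
  eliminateᵛ s v C = ⟦ eliminate ⟧ (adj G ∷ s ∷ v ∷ C ∷ [])

  attemptᵛ : Fin n → Val n state → Val n state
  attemptᵛ v s = ⟦ attempt k ⟧ (v ∷ s ∷ adj G ∷ W ∷ [])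

  Free : Val n state → VSet n
  Free s = outside-done (proj₁ s)

  Eligible : Val n state → Fin n → Bool
  Eligible s v = if Free s v then solvedᵛ k (component (Free s) v − v) W else false

  opaque
    unfolding component

    attempt-unfold : ∀ v s → attemptᵛ v s ≡ (if Eligible s v then eliminateᵛ s v (component (Free s) v) else s)
    attempt-unfold v s = refl

  module Step (s : Val n state) (I : Invariant s) (v : Fin n) (free : v ∊ Free s)
              (good : Solved {k} (component (Free s) v − v) W) where

    done₀ = proj₁ s
    cells₀ = proj₁ (proj₂ s)
    col₀ = proj₂ (proj₂ s)

    X K : VSet n
    X = Free s
    K = component X v

    s′ : Val n state
    s′ = eliminateᵛ s v K

    done₁ = proj₁ s′
    cells₁ = proj₁ (proj₂ s′)
    col₁ = proj₂ (proj₂ s′)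

    open Cells

    undone : ∀ {u} → u ∊ X → u ∌ done₀
    undone = if-not

    v∉done : v ∌ done₀
    v∉done = undone free

    v∈K : v ∊ K
    v∈K = component-refl free

    old≢v : ∀ {u} → u ∈ˡ hist I → u ≢ v
    old≢v u∈ refl = v∉done (hist⇒done I u∈)

    cells-v : cells₁ v ≡ K
    cells-v = put-same set cells₀ v K

    cells-old : ∀ {u} → u ∈ˡ hist I → cells₀ u ≡ cells₁ u
    cells-old u∈ = sym (put-other set cells₀ v K (old≢v u∈))

    boundary-done : ∀ {u} → u ∊ boundary K → u ∊ done₀
    boundary-done {u} b with member? done₀ u | boundary-elim b
    ... | inj₁ d | _ = d
    ... | inj₂ d | u∉K , w , w∈K , e = ⊥-elim (u∉K (component-step w∈K (not-if d) e))

    back : ∀ {u} → _⇡_ cells₁ v u → u ∊ boundary K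
    back {u} = subst (λ Y → u ∊ boundary Y) cells-v

    -- A neighbour of `u` in `K` lies in the cell of `u` by `attached`. A walk inside `K` cannot
    -- leave that cell, because it would leave through a parent of `u`, which is already eliminated.
    K⊆old : ∀ {u} → u ∊ boundary K → ∀ x → x ∊ K → x ∊ cells₀ u
    K⊆old {u} b x x∈K =
      let u∉K , w , w∈K , e = boundary-elim b
          w∈X = proj₂ (component⊆ w∈K)
          u∈done = boundary-done b
      in component-ind (_∊ cells₀ u) closed (attached I u∈done (undone w∈X) (trans (symmetric G u w) e))
           (component-trans (component-sym w∈K) x∈K)
      where
      closed : ∀ {y z} → y ∊ cells₀ u → y ∊ X → z ∊ X → Adj G y z → z ∊ cells₀ u
      closed {y} {z} y∈ _ z∈X e with member? (cells₀ u) z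
      ... | inj₁ z∈ = z∈
      ... | inj₂ z∉ = ⊥-elim (undone z∈X (hist⇒done I
              (above∈ cells₀ (history I) (done⇒hist I (boundary-done b)) (boundary-intro y∈ z∉ e))))

    new-placed : Placed cells₁ v (hist I)
    new-placed = record
      { own       = subst (v ∊_) (sym cells-v) v∈K
      ; excludes  = λ {u} u∈ u∈K → undone (proj₂ (component⊆ (subst (u ∊_) cells-v u∈K))) (hist⇒done I u∈)
      ; above     = λ e → done⇒hist I (boundary-done (back e))
      ; nested    = λ {u} e x x∈ → subst (x ∊_) (cells-old (done⇒hist I (boundary-done (back e))))
          (K⊆old (back e) x (subst (x ∊_) cells-v x∈))
      ; separator = proj₁ (remaining I v free)
      ; separates = λ {u} e → separates′ u (back e)
      }
      where
      -- `K` is the cell of `v` for the tuple `S`, so a neighbour of `K` missing from `S` would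
      -- belong to the cell.
      separates′ : ∀ u → u ∊ boundary K → u ∈ᵛ proj₁ (remaining I v free)
      separates′ u b with remaining I v free
      ... | S , _ , same with member? (blocked ∅ S) u
      ...   | inj₁ u∈ = [ (λ ()) , id ]′ (blocked-elim S u∈)
      ...   | inj₂ u∉ = let u∉K , w , w∈K , e = boundary-elim b in
        ⊥-elim (u∉K (trans (same u) (component-step (trans (sym (same w)) w∈K)
          (or-ifʳ {a = does (u ≟ v)} (not-if u∉)) e)))

    new-history : History cells₁ (v ∷ hist I)
    new-history = new-placed ∷ transport cells-old (history I)

    done-v : v ∊ done₁
    done-v = put-same bool done₀ v true

    done-old : ∀ {u} → u ∊ done₀ → u ∊ done₁
    done-old {u} d = trans (put-other bool done₀ v true λ { refl → v∉done d }) d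

    done-new : ∀ {u} → u ∊ done₁ → u ≡ v ⊎ u ∊ done₀
    done-new {u} d with u ≟ v
    ... | yes u≡v = inj₁ u≡v
    ... | no u≢v  = inj₂ d

    X′ : VSet n
    X′ = Free s′

    X′-elim : ∀ {u} → u ∊ X′ → u ∊ X × u ≢ v
    X′-elim p = not-if (if-not p ∘ done-old) , λ { refl → if-not p done-v }

    X′-intro : ∀ {u} → u ∊ X → u ≢ v → u ∊ X′
    X′-intro p u≢v = not-if ([ u≢v , undone p ]′ ∘ done-new)

    -- Only the component `K` is affected: inside it the winning choice of `v` applies, and the
    -- other components are unchanged.
    component-X′ : ∀ r → r ∊ X′ → Covered {k} (component X′ r) r W ∅
    component-X′ r r∈ with member? K r | X′-elim r∈
    ... | inj₁ r∈K | r∈X , r≢v =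
      let S , w , e = good r (−-intro K v r∈K r≢v) in S , w , λ u → trans (same-set
        (component-⊆ (λ _ p y e → let y∈X , y≢v = X′-elim y in
           −-intro K v (component-step (proj₁ (−-elim K v (proj₂ (component⊆ p)))) y∈X e) y≢v) (−-intro K v r∈K r≢v))
        (component-⊆ (λ _ _ y _ → let y∈K , y≢v = −-elim K v y in X′-intro (proj₂ (component⊆ y∈K)) y≢v) r∈) u) (e u)
    ... | inj₂ r∉K | r∈X , r≢v =
      let S , w , e = remaining I r r∈X in S , w , λ u → trans (same-set
        (component-⊆ (λ _ _ y _ → proj₁ (X′-elim y)) r∈X)
        (component-⊆ (λ {_} {y} p _ y∈ e → X′-intro y∈ λ { refl → r∉K (component-sym (component-step p y∈ e)) }) r∈) u) (e u)

    earlier : VSet n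
    earlier u = if done₀ u then ancestorsᵛ cells₁ v u else false

    new-colour : Fin n
    new-colour = ⟦ colour ⟧ (earlier ∷ col₀ ∷ v ∷ [])

    col-v : col₁ v ≡ new-colour
    col-v = put-same vtx col₀ v new-colour

    col-old : ∀ {u} → u ≢ v → col₁ u ≡ col₀ u
    col-old = put-other vtx col₀ v new-colour

    used : VSet n
    used c = some (λ u → if earlier u then does (col₀ u ≟ c) else false)

    used-elim : ∀ c → c ∊ used → ∃[ u ] (u ∊ earlier × col₀ u ≡ c)
    used-elim c p = let u , r = some-sound _ p ; u∈ , e = if-and r in u , u∈ , ≟-sound e

    v∉earlier : v ∌ earlier
    v∉earlier p = v∉done (proj₁ (if-and p))

    new-colour-fresh : new-colour ∌ used × toℕ new-colour < colours
    new-colour-fresh with least used n id v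
    -- The default colour is never taken: if all `n` colours were used on `earlier`, their users and
    -- `v` would be `suc n` distinct vertices.
    ... | inj₂ (_ , all-used) = ⊥-elim (<-irrefl refl (used-below ≤-refl col₀ earlier v∉earlier id
            (v , refl) (λ u _ → u , refl) (λ c _ → used-elim c (all-used c))))
    ... | inj₁ (c , eq , free , below) =
      let L , L-small , L-covers = few-ancestors cells₁ new-history q k v [] (here refl) [] (λ z ()) ≤-refl
          find : ∀ {u} → Ancestor cells₁ q v u → ∃[ i ] List.lookup L i ≡ u
          find {u} p = [ (λ u∈ → index u∈ , sym (lookup-indexˡ u∈)) , (λ ()) ]′ (L-covers u p)
      in subst (λ c → c ∌ used × toℕ c < colours) (sym eq) (free , ≤-trans
           (used-below (<⇒≤ (toℕ<n c)) col₀ earlier v∉earlier (List.lookup L) (find (Ancestor-refl cells₁ q))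
             (λ u u∈ → find (proj₁ (ancestors-correct cells₁ v u) (proj₂ (if-and {a = done₀ u} u∈))))
             (λ c lt → used-elim c (below c lt)))
           L-small)

    invariant : Invariant s′
    invariant = record
      { hist      = v ∷ hist I
      ; history   = new-history
      ; done⇒hist = λ d → [ here , there ∘ done⇒hist I ]′ (done-new d)
      ; hist⇒done = λ { (here refl) → done-v ; (there u∈) → done-old (hist⇒done I u∈) }
      ; attached  = λ {u} {x} u∈ x∉ e → attached′ u x (done-new u∈) (not-if (x∉ ∘ done-old)) x∉ e
      ; remaining = component-X′
      ; proper    = λ { {u = u} (here refl) p u≢v → proper-new u p u≢v
                      ; {w} {u} (there w∈) p u≢w → proper-old w u w∈ p u≢w }
      ; few       = λ { (here refl) → subst (λ c → toℕ c < colours) (sym col-v) (proj₂ new-colour-fresh)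
                      ; (there w∈) → subst (λ c → toℕ c < colours) (sym (col-old (old≢v w∈))) (few I w∈) }
      }
      where
      attached′ : ∀ u x → u ≡ v ⊎ u ∊ done₀ → x ∊ X → x ∌ done₁ → Adj G u x → x ∊ cells₁ u
      attached′ u x (inj₁ refl) x∈X _ e = subst (x ∊_) (sym cells-v) (component-step v∈K x∈X e)
      attached′ u x (inj₂ d) x∈X _ e = subst (x ∊_) (cells-old (done⇒hist I d)) (attached I d (undone x∈X) e)

      proper-new : ∀ u → Ancestor cells₁ q v u → u ≢ v → col₁ u ≢ col₁ v
      proper-new u p u≢v eq = proj₁ new-colour-fresh (some-complete _ u (and-if
        (and-if (earlier-done (Ancestor∈ cells₁ new-history q (here refl) p)) (proj₂ (ancestors-correct cells₁ v u) p))
        (≟-complete (trans (sym (col-old u≢v)) (trans eq col-v)))))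
        where
        earlier-done : u ∈ˡ v ∷ hist I → u ∊ done₀
        earlier-done (here refl) = ⊥-elim (u≢v refl)
        earlier-done (there u∈)  = hist⇒done I u∈

      proper-old : ∀ w u → w ∈ˡ hist I → Ancestor cells₁ q w u → u ≢ w → col₁ u ≢ col₁ w
      proper-old w u w∈ p u≢w eq =
        let p′ = Ancestor-transport cells-old (history I) q w∈ p
        in proper I w∈ p′ u≢w (trans (sym (col-old (old≢v (Ancestor∈ cells₀ (history I) q w∈ p′))))
             (trans eq (col-old (old≢v w∈))))

  measure : Val n state → ℕ
  measure s = size-of (proj₁ s)

  attempt-eligible : ∀ v s → Eligible s v ≡ true → attemptᵛ v s ≡ eliminateᵛ s v (component (Free s) v)
  attempt-eligible v s eligible = trans (attempt-unfold v s)
    (cong (λ b → if b then eliminateᵛ s v (component (Free s) v) else s) eligible)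

  attempt-ineligible : ∀ v s → Eligible s v ≡ false → attemptᵛ v s ≡ s
  attempt-ineligible v s ineligible = trans (attempt-unfold v s)
    (cong (λ b → if b then eliminateᵛ s v (component (Free s) v) else s) ineligible)

  decide : ∀ b → b ≡ true ⊎ b ≡ false
  decide true  = inj₁ refl
  decide false = inj₂ refl

  attempt-invariant : ∀ v s → Invariant s → Invariant (attemptᵛ v s)
  attempt-invariant v s I = [ (λ eligible → let free , good = if-and {a = Free s v} eligible in
      subst Invariant (sym (attempt-eligible v s eligible)) (Step.invariant s I v free (solved-sound k good)))
    , (λ ineligible → subst Invariant (sym (attempt-ineligible v s ineligible)) I) ]′ (decide (Eligible s v))

  attempt-active : ∀ v s → Eligible s v ≡ true → measure s < measure (attemptᵛ v s)
  attempt-active v s eligible = subst (λ s′ → measure s < measure s′) (sym (attempt-eligible v s eligible))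
    (size-of-< (proj₁ s) (putᵛ bool (proj₁ s) v true)
      (λ u d → trans (put-other bool (proj₁ s) v true λ { refl → v∉done d }) d)
      (put-same bool (proj₁ s) v true) v∉done)
    where
    v∉done : v ∌ proj₁ s
    v∉done = if-not (proj₁ (if-and {a = Free s v} eligible))

  attempt-grows : ∀ v s → attemptᵛ v s ≡ s ⊎ measure s < measure (attemptᵛ v s)
  attempt-grows v s = [ inj₂ ∘ attempt-active v s , inj₁ ∘ attempt-ineligible v s ]′ (decide (Eligible s v))

  -- The component of `u` is marked as won by `remaining`, and `winning-sound` yields a winning
  -- choice in it.
  exists-eligible : ∀ s → Invariant s → ∀ {u} → u ∊ Free s → ∃[ v ] Eligible s v ≡ true
  exists-eligible s I {u} free =
    let S , won , same = remaining I u free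
        v , v∈cell , good = winning-sound k S u won
        v∈ = trans (same v) v∈cell
        same′ : ∀ w → cellᵛ (blocked ∅ S) u w ≡ component (Free s) v w
        same′ w = trans (sym (same w))
          (same-set {X = component (Free s) u} {Y = component (Free s) v}
            (λ _ → component-trans (component-sym v∈)) (λ _ → component-trans v∈) w)
    in v , and-if {a = Free s v} (proj₂ (component⊆ v∈)) (solved-complete k
      (Solved-cong {X = cellᵛ (blocked ∅ S) u − v} {Y = component (Free s) v − v}
        (λ w → cong (λ b → if b then (if does (w ≟ v) then false else true) else false) (same′ w)) good))

  sweep : Val n state → Val n state
  sweep s = foldFin n attemptᵛ s

  sweep-progress : ∀ s → Invariant s → measure s < measure (sweep s) ⊎ n ≤ measure s
  sweep-progress s I with any? (λ u → Free s u Bool.≟ true)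
  ... | yes (u , free) = let v , eligible = exists-eligible s I free in
    inj₁ (foldFin-progress measure attempt-grows s (v , attempt-active v s eligible))
  ... | no none = inj₂ (subst (_≤ measure s) (∣⊤∣≡n n)
    (p⊆q⇒∣p∣≤∣q∣ {p = ⊤} {q = tabulate (proj₁ s)} λ {u} _ → ∈-tabulate {X = proj₁ s} (finished u)))
    where
    finished : ∀ u → u ∊ proj₁ s
    finished u with member? (proj₁ s) u
    ... | inj₁ d = d
    ... | inj₂ d = ⊥-elim (none (u , not-if d))

  finalᵛ : Val n state
  finalᵛ = ⟦ final k ⟧ (adj G ∷ W ∷ [])

  final-correct : Solved {k} (λ _ → true) W → Invariant finalᵛ × ∀ u → u ∊ proj₁ finalᵛ
  final-correct solved = proj₁ result , λ u → ∈-tabulate⁻ {X = proj₁ finalᵛ}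
    (subst (u ∈_) (sym (∣p∣≡n⇒p≡⊤ (≤-antisym (∣p∣≤n (tabulate (proj₁ finalᵛ))) ([ id , id ]′ (proj₂ result))))) ∈⊤)
    where

    initial : Invariant ((λ _ → false) , (λ _ _ → false) , id)
    initial = record
      { hist = [] ; history = Cells.[] ; done⇒hist = λ () ; hist⇒done = λ () ; attached = λ () ; remaining = solved
      ; proper = λ () ; few = λ () }

    result : Invariant finalᵛ × (n ≤ measure finalᵛ ⊎ n ≤ measure finalᵛ)
    result = foldFin-count {m = n} {f = λ _ → sweep} (λ i s → Invariant s × (i ≤ measure s ⊎ n ≤ measure s))
      (λ _ i s (I , p) → foldFin-invariant {m = n} Invariant attempt-invariant s I ,
        [ (λ i≤ → [ (λ lt → inj₁ (≤-<-trans i≤ lt)) , (λ n≤ → inj₂ (≤-trans n≤ (grow s))) ]′ (sweep-progress s I))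
        , (λ n≤ → inj₂ (≤-trans n≤ (grow s))) ]′ p)
      ((λ _ → false) , (λ _ _ → false) , id) (initial , inj₁ z≤n)
      where
      grow : ∀ s → measure s ≤ measure (sweep s)
      grow = foldFin-monotone measure attempt-grows

-- Centredness

unique-size : ∀ {m} (p : Subset m) {xs} → Unique xs → (∀ x → x ∈ˡ xs → x ∈ p) → length xs ≤ ∣ p ∣
unique-size p []        inc = z≤n
unique-size p {x ∷ xs} (x∉ ∷ u) inc = ≤-trans
  (s≤s (unique-size (p ∖ x) u λ y y∈ → x∈p∧x≢y⇒x∈p-y (inc y (there y∈)) λ y≡x → All.lookup x∉ y∈ (sym y≡x)))
  (x∈p⇒∣p-x∣<∣p∣ (inc x (here refl)))

C-mono : ∀ {m n} k → m ≤ n → m C k ≤ n C k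
C-mono {m} {n} k m≤n = subst (λ n → m C k ≤ n C k) (m∸n+n≡m m≤n) (grow (n ∸ m))
  where
  suc-mono : ∀ m k → m C k ≤ suc m C k
  suc-mono m zero    = ≤-refl
  suc-mono m (suc k) = ≤-trans (m≤n+m _ (m C k)) (≤-reflexive (nCk+nC[k+1]≡[n+1]C[k+1] m k))

  grow : ∀ d → m C k ≤ (d + m) C k
  grow zero    = ≤-refl
  grow (suc d) = ≤-trans (grow d) (suc-mono (d + m) k)

∈-image : ∀ {n q} (col : Coloring n q) (X : Subset n) {u} → u ∈ X → col u ∈ image col X
∈-image col X {u} u∈ = lookup⇒[]= (col u) _ (trans (lookup∘tabulate _ (col u))
  (dec-true (any? λ v → (v ∈? X) ×-dec (col v ≟ col u)) (u , u∈ , refl)))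

module Centring {n q : ℕ} (q≤n : q ≤ n) (k : ℕ) (G : Graph n) {s : Val n state}
  (I : Main.Invariant q≤n k G s) (all-placed : ∀ u → u ∈ˡ Main.Invariant.hist I) where

  open Algorithm q≤n G using (boundary; boundary-intro)
  open Main q≤n k G
  open Invariant I hiding (done)
  open Cells (proj₁ (proj₂ s))
  open Placed

  module Inside (H : Subgraph G) (connected : Connected H) where

    X : Subset n
    X = vertices H

    leave : ∀ {Y x y} → x ∊ Y → y ∌ Y → Star (Edge H) x y → ∃[ a ] ∃[ b ] (Edge H a b × a ∊ Y × b ∌ Y)
    leave x∈ y∉ ε = ⊥-elim (y∉ x∈)
    leave {Y} {x} x∈ y∉ (_◅_ {j = z} e r) with member? Y z
    ... | inj₁ z∈ = leave z∈ y∉ r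
    ... | inj₂ z∉ = x , z , e , x∈ , z∉

    Root : List (Fin n) → Fin n → Set
    Root h v = v ∈ˡ h × v ∈ X × (∀ u → u ∈ˡ h → u ∈ X → u ≢ v → v ∌ cells u)

    -- The oldest vertex of `X` is the root, since no cell contains a vertex older than its owner.
    root-or-none : ∀ {h} → History h → (∃[ v ] Root h v) ⊎ (∀ u → u ∈ˡ h → ¬ (u ∈ X))
    root-or-none [] = inj₂ λ u ()
    root-or-none {w ∷ h} (p ∷ H′) with root-or-none H′ | w ∈? X
    ... | inj₁ (v , v∈h , v∈X , root) | _ = inj₁ (v , there v∈h , v∈X ,
      λ { u (here refl) _ _ → excludes p v∈h ; u (there u∈) → root u u∈ })
    ... | inj₂ none | yes w∈X = inj₁ (w , here refl , w∈X ,
      λ { u (here refl) _ u≢w → ⊥-elim (u≢w refl) ; u (there u∈) u∈X → ⊥-elim (none u u∈ u∈X) })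
    ... | inj₂ none | no w∉X = inj₂ λ { u (here refl) → w∉X ; u (there u∈) → none u u∈ }

    root : ∃[ v ] Root hist v
    root = let (u , u∈X) , _ = connected in
      [ id , (λ none → ⊥-elim (none u (all-placed u) u∈X)) ]′ (root-or-none history)

    v : Fin n
    v = proj₁ root

    v∈X : v ∈ X
    v∈X = proj₁ (proj₂ (proj₂ root))

    parent : ∀ {u} → u ∈ X → u ≢ v → ∃[ y ] (u ⇡ y × y ∈ X)
    parent {u} u∈X u≢v =
      let _ , p , _ = placed history (all-placed u)
          a , b , e , a∈ , b∉ = leave {Y = proj₁ (proj₂ s) u} (own p) (proj₂ (proj₂ (proj₂ root)) u (all-placed u) u∈X u≢v)
                                  (proj₂ connected u v u∈X v∈X)
      in b , boundary-intro {X = proj₁ (proj₂ s) u} a∈ b∉ (edge⇒adj H a b e) , edge⇒∈ H b a (trans (edge-sym H b a) e)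

    irreflexive : ∀ {u y} i → u ⇡ y → Ancestor i y u → ⊥
    irreflexive {u} i u⇡y p = let _ , pl , _ , H′ = placed history (all-placed u) in
      excludes pl (Ancestor∈ (proj₁ (proj₂ s)) H′ i (above pl u⇡y) p) (own pl)

    Rainbow : List (Fin n) → Set
    Rainbow = AllPairs (λ x y → col x ≢ col y)

    -- That the listed vertices are ancestors of `u` is carried along so that `proper` separates the
    -- next vertex from all of them at once.
    chain : ∀ i → i ≤ q → ∀ {u} → u ∈ X → Ancestor i u v ⊎
      ∃[ l ] (length l ≡ suc i × All (_∈ X) l × Rainbow l × All (Ancestor i u) l)
    chain zero    i≤q {u} u∈X = inj₂ (u ∷ [] , refl , u∈X ∷ [] , [] ∷ [] , refl ∷ [])
    chain (suc i) i<q {u} u∈X with u ≟ v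
    ... | yes u≡v = inj₁ (inj₁ u≡v)
    ... | no u≢v with parent u∈X u≢v
    ...   | y , u⇡y , y∈X with chain i (<⇒≤ i<q) y∈X
    ...     | inj₁ p = inj₁ (inj₂ (y , u⇡y , p))
    ...     | inj₂ (l , len , inside , rainbow , up) = inj₂ (u ∷ l , cong suc len , u∈X ∷ inside ,
              All.map (λ p eq → proper (all-placed u) (raise i<q (inj₂ (y , u⇡y , p)))
                (λ { refl → irreflexive i u⇡y p }) (sym eq)) up ∷ rainbow ,
              inj₁ refl ∷ All.map (λ p → inj₂ (y , u⇡y , p)) up)
      where
      raise : ∀ {i j x z} → i ≤ j → Ancestor i x z → Ancestor j x z
      raise {i} {j} {x} {z} i≤j p = subst (λ j → Ancestor j x z) (m∸n+n≡m i≤j) (go (j ∸ i))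
        where
        go : ∀ d → Ancestor (d + i) x z
        go zero    = p
        go (suc d) = Ancestor-suc (d + i) (go d)

  centered : ∀ {f} p → q ≡ p ⊎ q ≡ n → (colour′ : Coloring n f) →
    (∀ {u w} → colour′ u ≡ colour′ w → col u ≡ col w) → Centered p G colour′
  centered p q≡ colour′ reflects H connected with suc p ≤? ∣ image colour′ (vertices H) ∣
  ... | yes many = inj₁ many
  ... | no few-colours = inj₂ (colour′ v , v , (v∈X , refl) , unique)
    where
    open Inside H connected

    unique : ∀ {y} → y ∈ X × colour′ y ≡ colour′ v → v ≡ y
    unique {y} (y∈X , same) with v ≟ y | chain q ≤-refl y∈X
    ... | yes v≡y | _ = v≡y
    ... | no v≢y | inj₁ p = ⊥-elim (proper (all-placed y) p v≢y (sym (reflects same)))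
    ... | no v≢y | inj₂ (l , len , inside , rainbow , _) = ⊥-elim ([ too-many-colours , too-many-vertices ]′ q≡)
      where
      -- Truncating the radius at `n` loses nothing, as there are no `suc n` vertices of distinct
      -- colours.
      too-many-vertices : q ≢ n
      too-many-vertices q≡n = <-irrefl refl (subst (_≤ n) (trans len (cong suc q≡n))
        (unique-length id (AllPairs.map (λ d eq → d (cong col eq)) rainbow) (λ x _ → x , refl)))

      too-many-colours : q ≢ p
      too-many-colours q≡p = few-colours (subst (_≤ ∣ image colour′ X ∣)
        (trans (length-map colour′ l) (trans len (cong suc q≡p)))
        (unique-size (image colour′ X) (AllPairs.map⁺ (AllPairs.map (_∘ reflects) rainbow))
          λ c c∈ → All.lookup {P = _∈ image colour′ X} (All.map⁺ (All.map (∈-image colour′ X) inside)) c∈))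

lemma15 : ∀ (k : ℕ) → AdmitsPolyTimeCenteredColorings (TreewidthAtMost k) (λ p → (p + k) C k)
lemma15 k = program (colouring k) , proj₁ (poly-1⊔ (total-poly (colouring k))) , λ p {n} G tw →
  let q≤n = m⊓n≤n p n
      open Main q≤n k G
      I , finished = final-correct (Completeness.solved-full q≤n G (elimination tw))
      open Invariant I hiding (done)
      placed : ∀ u → u ∈ˡ hist
      placed u = done⇒hist (finished u)
      bounded : ∀ u → toℕ (col u) < (p + k) C k
      bounded u = ≤-trans (few (placed u)) (C-mono k (+-monoˡ-≤ k (m⊓n≤m p n)))
      -- The program produces colours in `Fin n`. Their numbers are kept, so the encoded output is
      -- the same.
      colour′ : Coloring n ((p + k) C k)
      colour′ u = fromℕ< (bounded u)
      t , run , t≤ = program-run (colouring k) p G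
  in colour′ , t ,
     subst (program (colouring k) ⟨ encodeℕ p ∙ encodeGraph G ⟩⇓[ t ]_)
       (cong encodeList (List-tabulate-cong λ u → cong encodeℕ (sym (toℕ-fromℕ< (bounded u))))) run ,
     ≤-trans t≤ (proj₂ (poly-1⊔ (total-poly (colouring k))) n) ,
     Centring.centered q≤n k G I placed p (⊓-sel p n) colour′
       λ {u} {w} eq → toℕ-injective (trans (sym (toℕ-fromℕ< (bounded u))) (trans (cong toℕ eq) (toℕ-fromℕ< (bounded w))))
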